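{- Let $\Phi=(D,\varphi)$ be a $\mathbb{T}$-gain digraph on $n$ vertices. Let $\mathcal{E}_k(D)$ be the set of all elementary subdigraphs of $D$ covering exactly $k$ vertices. Then the characteristic polynomial of $A(\Phi)$ is $$\det(\lambda I-A(\Phi))=\sum_{k=0}^{n}a_k(\Phi)\,\lambda^{n-k},$$ where $a_0(\Phi)=1$ and $a_k(\Phi)=\sum_{\mathsf{E}\in\mathcal{E}_k(D)}(-1)^{c(\mathsf{E})}\varphi(\mathsf{E})$ for $k=1,\dots,n$.
   Context: A digraph $D=(V,\mathcal{A})$ has a finite vertex set $V=\{v_1,\dots,v_n\}$ and a set $\mathcal{A}$ of ordered pairs of distinct vertices, called arcs (no loops; at most one arc from $v_i$ to $v_j$ for each ordered pair; opposite arcs may both be present). A directed cycle is a closed directed walk whose vertices are distinct except that the first and last coincide (so its length is at least $2$; length $2$ is allowed). Let $\mathbb{T}=\{z\in\mathbb{C}:|z|=1\}$. A $\mathbb{T}$-gain digraph is a pair $\Phi=(D,\varphi)$ with $\varphi:\mathcal{A}\to\mathbb{T}$ an arbitrary function. Its gain adjacency matrix $A(\Phi)$ has entries $A(\Phi)_{ij}=\varphi(v_i,v_j)$ if $(v_i,v_j)\in\mathcal{A}$ and $0$ otherwise. An elementary subdigraph of $D$ is a subdigraph in which every vertex has in-degree and out-degree exactly $1$, equivalently a vertex-disjoint union of directed cycles of $D$. $c(\mathsf{E})$ is the number of directed cycles composing $\mathsf{E}$, and $\varphi(\mathsf{E})$ is the product of the gains $\varphi(C)$ of these cycles, where the gain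 of a directed cycle is the product of the gains of its arcs. -}

module Defs where

open import Level using (0ℓ)
open import Algebra.Bundles using (RawRing; CommutativeRing; module CommutativeRing)
import Algebra.Consequences.Setoid as Consequences
import Algebra.Definitions.RawSemiring as RawSemiringOps
open import Data.Bool.Base using (if_then_else_)
open import Data.Empty using () renaming (⊥ to Empty)
open import Data.Fin.Base as Fin using (Fin; zero; suc; toℕ; punchIn)
import Data.Fin.Properties as Fin
open import Data.Fin.Subset using (Subset; _∈_; _∉_; ∣_∣; inside; outside)
open import Data.Fin.Subset.Properties using (_∈?_)
open import Data.List.Base as List using (List; []; _∷_; _∷ʳ_)
open import Data.List.Relation.Unary.All using (All; all?)
open import Data.List.Relation.Unary.Linked using (Linked; linked?)
open import Data.List.Relation.Unary.Unique.Propositional using (Unique)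
import Data.List.Relation.Unary.Unique.DecPropositional as DecUnique
open import Data.Nat.Base as ℕ using (ℕ; zero; suc)
import Data.Nat.Properties as ℕ
open import Data.Product.Base using (∃; _×_; _,_)
open import Data.Rational.Base as ℚ using (ℚ; 0ℚ; 1ℚ; ½)
import Data.Rational.Properties as ℚ
import Data.Rational.Solver as ℚSolver
open import Data.Vec.Base as Vec using (Vec; []; _∷_; lookup)
open import Relation.Binary.Bundles using (Setoid)
open import Relation.Binary.Structures using (IsEquivalence)
open import Relation.Binary.PropositionalEquality
  using (_≡_; refl; sym; trans; cong; subst)
open import Relation.Nullary.Decidable
  using (Dec; yes; no; does; _×-dec_; _→-dec_)

-- Real numbers are rational Cauchy sequences modulo null sequences.
-- x ∼ y says that x m - y n tends to 0 as m and n tend to infinity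
-- independently.  Thus x ∼ x says that x is a Cauchy sequence, and for
-- Cauchy sequences x ∼ y says that x - y is a null sequence.
infix 4 _∼_
_∼_ : (x y : ℕ → ℚ) → Set
x ∼ y = ∀ ε → 0ℚ ℚ.< ε →
        ∃ λ N → ∀ m n → N ℕ.≤ m → N ℕ.≤ n → ℚ.∣ x m ℚ.- y n ∣ ℚ.≤ ε

record ℝ : Set where
  constructor mkℝ
  field
    seq    : ℕ → ℚ
    cauchy : seq ∼ seq
open ℝ public

infix 4 _≈ᵣ_ _≤ᵣ_
record _≈ᵣ_ (x y : ℝ) : Set where
  constructor mk≈
  field
    seq-∼ : seq x ∼ seq y
open _≈ᵣ_ public

_≤ᵣ_ : ℝ → ℝ → Set
x ≤ᵣ y = ∀ ε → 0ℚ ℚ.< ε →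
         ∃ λ N → ∀ n → N ℕ.≤ n → seq x n ℚ.≤ seq y n ℚ.+ ε

private
  open module Solver = ℚSolver.+-*-Solver using (solve; con; _:=_; _:+_; _:-_; _:*_; :-_)

abstract
  private
    half-pos : ∀ {ε} → 0ℚ ℚ.< ε → 0ℚ ℚ.< ½ ℚ.* ε
    half-pos {ε} 0<ε = ℚ.positive⁻¹ (½ ℚ.* ε)
      {{ℚ.pos*pos⇒pos ½ ε {{ℚ.positive 0<ε}}}}

    half+half : ∀ ε → ½ ℚ.* ε ℚ.+ ½ ℚ.* ε ≡ ε
    half+half ε = trans (sym (ℚ.*-distribʳ-+ ε ½ ½)) (ℚ.*-identityˡ ε)

    split : ∀ {a b} c ε → c ≡ a ℚ.+ b →
            ℚ.∣ a ∣ ℚ.≤ ½ ℚ.* ε → ℚ.∣ b ∣ ℚ.≤ ½ ℚ.* ε → ℚ.∣ c ∣ ℚ.≤ ε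
    split {a} {b} _ ε refl p q =
      ℚ.≤-trans (ℚ.∣p+q∣≤∣p∣+∣q∣ a b)
        (ℚ.≤-trans (ℚ.+-mono-≤ p q) (ℚ.≤-reflexive (half+half ε)))

    maxˡ : ∀ {M N m} → M ℕ.⊔ N ℕ.≤ m → M ℕ.≤ m
    maxˡ = ℕ.m⊔n≤o⇒m≤o _ _

    maxʳ : ∀ {M N m} → M ℕ.⊔ N ℕ.≤ m → N ℕ.≤ m
    maxʳ = ℕ.m⊔n≤o⇒n≤o _ _

    swap-≡ : ∀ a b → b ℚ.- a ≡ ℚ.- (a ℚ.- b)
    swap-≡ = solve 2 (λ a b → b :- a := :- (a :- b)) refl

    swap-∣∣ : ∀ a b → ℚ.∣ b ℚ.- a ∣ ≡ ℚ.∣ a ℚ.- b ∣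
    swap-∣∣ a b = trans (cong ℚ.∣_∣ (swap-≡ a b)) (ℚ.∣-p∣≡∣p∣ (a ℚ.- b))

    trans-≡ : ∀ a b c → a ℚ.- c ≡ (a ℚ.- b) ℚ.+ (b ℚ.- c)
    trans-≡ = solve 3 (λ a b c → a :- c := (a :- b) :+ (b :- c)) refl

    +-≡ : ∀ a b c d → (a ℚ.+ b) ℚ.- (c ℚ.+ d) ≡ (a ℚ.- c) ℚ.+ (b ℚ.- d)
    +-≡ = solve 4 (λ a b c d → (a :+ b) :- (c :+ d) := (a :- c) :+ (b :- d)) refl

    neg-≡ : ∀ a b → (ℚ.- a) ℚ.- (ℚ.- b) ≡ ℚ.- (a ℚ.- b)
    neg-≡ = solve 2 (λ a b → (:- a) :- (:- b) := :- (a :- b)) refl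

    *-≡ : ∀ a b c d → (a ℚ.* b) ℚ.- (c ℚ.* d) ≡ a ℚ.* (b ℚ.- d) ℚ.+ d ℚ.* (a ℚ.- c)
    *-≡ = solve 4 (λ a b c d → (a :* b) :- (c :* d) := a :* (b :- d) :+ d :* (a :- c)) refl

    cancel-≡ : ∀ a b → a ≡ (a ℚ.- b) ℚ.+ b
    cancel-≡ = solve 2 (λ a b → a := (a :- b) :+ b) refl

  ∼-sym : ∀ {x y} → x ∼ y → y ∼ x
  ∼-sym {x} {y} p ε 0<ε with p ε 0<ε
  ... | N , h = N , λ m n N≤m N≤n →
        subst (ℚ._≤ ε) (sym (swap-∣∣ (x n) (y m))) (h n m N≤n N≤m)

  ∼-trans : ∀ {x y z} → x ∼ y → y ∼ z → x ∼ z
  ∼-trans {x} {y} {z} p q ε 0<ε with p (½ ℚ.* ε) (half-pos 0<ε) | q (½ ℚ.* ε) (half-pos 0<ε)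
  ... | M , h | N , k = M ℕ.⊔ N , λ m n M⊔N≤m M⊔N≤n →
        split _ ε (trans-≡ (x m) (y m) (z n))
          (h m m (maxˡ M⊔N≤m) (maxˡ M⊔N≤m)) (k m n (maxʳ M⊔N≤m) (maxʳ M⊔N≤n))

  +-resp-∼ : ∀ {x x′ y y′} → x ∼ x′ → y ∼ y′ →
             (λ n → x n ℚ.+ y n) ∼ (λ n → x′ n ℚ.+ y′ n)
  +-resp-∼ {x} {x′} {y} {y′} p q ε 0<ε with p (½ ℚ.* ε) (half-pos 0<ε) | q (½ ℚ.* ε) (half-pos 0<ε)
  ... | M , h | N , k = M ℕ.⊔ N , λ m n M⊔N≤m M⊔N≤n →
        split _ ε (+-≡ (x m) (y m) (x′ n) (y′ n))
          (h m n (maxˡ M⊔N≤m) (maxˡ M⊔N≤n)) (k m n (maxʳ M⊔N≤m) (maxʳ M⊔N≤n))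

  -‿resp-∼ : ∀ {x x′} → x ∼ x′ → (λ n → ℚ.- x n) ∼ (λ n → ℚ.- x′ n)
  -‿resp-∼ {x} {x′} p ε 0<ε with p ε 0<ε
  ... | N , h = N , λ m n N≤m N≤n →
        subst (ℚ._≤ ε)
          (sym (trans (cong ℚ.∣_∣ (neg-≡ (x m) (x′ n))) (ℚ.∣-p∣≡∣p∣ (x m ℚ.- x′ n))))
          (h m n N≤m N≤n)

  private
    bounded : ∀ {x y} → x ∼ y →
              ∃ λ B → 0ℚ ℚ.< B × ∃ λ N → ∀ m → N ℕ.≤ m → ℚ.∣ x m ∣ ℚ.≤ B
    bounded {x} {y} p with p 1ℚ (ℚ.positive⁻¹ 1ℚ)
    ... | N , h =
      1ℚ ℚ.+ ℚ.∣ y N ∣ ,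
      ℚ.+-mono-<-≤ (ℚ.positive⁻¹ 1ℚ) (ℚ.0≤∣p∣ (y N)) ,
      N , λ m N≤m →
        ℚ.≤-trans (ℚ.≤-reflexive (cong ℚ.∣_∣ (cancel-≡ (x m) (y N))))
          (ℚ.≤-trans (ℚ.∣p+q∣≤∣p∣+∣q∣ (x m ℚ.- y N) (y N))
            (ℚ.+-monoˡ-≤ ℚ.∣ y N ∣ (h m N N≤m ℕ.≤-refl)))

    divide : ∀ B ε → 0ℚ ℚ.< B → 0ℚ ℚ.< ε → ∃ λ δ → 0ℚ ℚ.< δ × B ℚ.* δ ≡ ε
    divide B ε 0<B 0<ε = 1/B ℚ.* ε ,
      ℚ.positive⁻¹ (1/B ℚ.* ε)
        {{ℚ.pos*pos⇒pos 1/B {{ℚ.1/pos⇒pos B}} ε {{ℚ.positive 0<ε}}}} ,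
      trans (sym (ℚ.*-assoc B 1/B ε))
        (trans (cong (ℚ._* ε) (ℚ.*-inverseʳ B)) (ℚ.*-identityˡ ε))
      where
      instance
        B-pos : ℚ.Positive B
        B-pos = ℚ.positive 0<B
        B-nonZero : ℚ.NonZero B
        B-nonZero = ℚ.pos⇒nonZero B
      1/B : ℚ
      1/B = ℚ.1/ B

    *-bound : ∀ {B δ} a d → 0ℚ ℚ.< B → ℚ.∣ a ∣ ℚ.≤ B → ℚ.∣ d ∣ ℚ.≤ δ →
              ℚ.∣ a ℚ.* d ∣ ℚ.≤ B ℚ.* δ
    *-bound {B} {δ} a d 0<B ∣a∣≤B ∣d∣≤δ =
      ℚ.≤-trans (ℚ.≤-reflexive (ℚ.∣p*q∣≡∣p∣*∣q∣ a d))
        (ℚ.≤-trans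
          (ℚ.*-monoʳ-≤-nonNeg ℚ.∣ d ∣ {{ℚ.nonNegative (ℚ.0≤∣p∣ d)}} ∣a∣≤B)
          (ℚ.*-monoˡ-≤-nonNeg B {{ℚ.nonNegative (ℚ.<⇒≤ 0<B)}} ∣d∣≤δ))

  private
    *-estimate : ∀ {B C δ η a b c d} ε → 0ℚ ℚ.< B → 0ℚ ℚ.< C →
      B ℚ.* δ ≡ ½ ℚ.* ε → C ℚ.* η ≡ ½ ℚ.* ε →
      ℚ.∣ a ∣ ℚ.≤ B → ℚ.∣ d ∣ ℚ.≤ C →
      ℚ.∣ b ℚ.- d ∣ ℚ.≤ δ → ℚ.∣ a ℚ.- c ∣ ℚ.≤ η →
      ℚ.∣ a ℚ.* b ℚ.- c ℚ.* d ∣ ℚ.≤ ε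
    *-estimate {B} {C} {δ} {η} {a} {b} {c} {d} ε 0<B 0<C Bδ≡ Cη≡ ∣a∣≤B ∣d∣≤C ∣b-d∣≤δ ∣a-c∣≤η =
      split (a ℚ.* b ℚ.- c ℚ.* d) ε (*-≡ a b c d)
        (subst (ℚ.∣ a ℚ.* (b ℚ.- d) ∣ ℚ.≤_) Bδ≡ (*-bound a (b ℚ.- d) 0<B ∣a∣≤B ∣b-d∣≤δ))
        (subst (ℚ.∣ d ℚ.* (a ℚ.- c) ∣ ℚ.≤_) Cη≡ (*-bound d (a ℚ.- c) 0<C ∣d∣≤C ∣a-c∣≤η))

  *-resp-∼ : ∀ {x x′ y y′} → x ∼ x′ → y ∼ y′ →
             (λ n → x n ℚ.* y n) ∼ (λ n → x′ n ℚ.* y′ n)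
  *-resp-∼ {x} {x′} {y} {y′} p q ε 0<ε =
    let B , 0<B , N₁ , hB = bounded {x} {x′} p
        C , 0<C , N₂ , hC = bounded {y′} {y} (∼-sym {y} {y′} q)
        δ , 0<δ , Bδ≡     = divide B (½ ℚ.* ε) 0<B (half-pos 0<ε)
        η , 0<η , Cη≡     = divide C (½ ℚ.* ε) 0<C (half-pos 0<ε)
        N₃ , h            = q δ 0<δ
        N₄ , k            = p η 0<η
    in (N₁ ℕ.⊔ N₂) ℕ.⊔ (N₃ ℕ.⊔ N₄) , λ m n N≤m N≤n →
      *-estimate {B} {C} {δ} {η} {x m} {y m} {x′ n} {y′ n} ε 0<B 0<C Bδ≡ Cη≡
        (hB m (maxˡ {N₁} {N₂} (maxˡ {N₁ ℕ.⊔ N₂} {N₃ ℕ.⊔ N₄} N≤m)))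
        (hC n (maxʳ {N₁} {N₂} (maxˡ {N₁ ℕ.⊔ N₂} {N₃ ℕ.⊔ N₄} N≤n)))
        (h m n (maxˡ {N₃} {N₄} (maxʳ {N₁ ℕ.⊔ N₂} {N₃ ℕ.⊔ N₄} N≤m))
               (maxˡ {N₃} {N₄} (maxʳ {N₁ ℕ.⊔ N₂} {N₃ ℕ.⊔ N₄} N≤n)))
        (k m n (maxʳ {N₃} {N₄} (maxʳ {N₁ ℕ.⊔ N₂} {N₃ ℕ.⊔ N₄} N≤m))
               (maxʳ {N₃} {N₄} (maxʳ {N₁ ℕ.⊔ N₂} {N₃ ℕ.⊔ N₄} N≤n)))

  const-∼ : ∀ q → (λ _ → q) ∼ (λ _ → q)
  const-∼ q ε 0<ε = 0 , λ _ _ _ _ →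
    subst (ℚ._≤ ε) (sym (cong ℚ.∣_∣ (ℚ.+-inverseʳ q))) (ℚ.<⇒≤ 0<ε)

  ≗⇒≈ᵣ : ∀ x y → (∀ n → seq x n ≡ seq y n) → x ≈ᵣ y
  ≗⇒≈ᵣ x y x≗y = mk≈ λ ε 0<ε →
    let N , h = cauchy x ε 0<ε
    in N , λ m n N≤m N≤n →
         subst (λ q → ℚ.∣ seq x m ℚ.- q ∣ ℚ.≤ ε) (x≗y n) (h m n N≤m N≤n)

infixl 6 _+ᵣ_
infixl 7 _*ᵣ_
infix  8 -ᵣ_

_+ᵣ_ _*ᵣ_ : ℝ → ℝ → ℝ
x +ᵣ y = mkℝ (λ n → seq x n ℚ.+ seq y n)
  (+-resp-∼ {seq x} {seq x} {seq y} {seq y} (cauchy x) (cauchy y))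
x *ᵣ y = mkℝ (λ n → seq x n ℚ.* seq y n)
  (*-resp-∼ {seq x} {seq x} {seq y} {seq y} (cauchy x) (cauchy y))

-ᵣ_ : ℝ → ℝ
-ᵣ x = mkℝ (λ n → ℚ.- seq x n) (-‿resp-∼ {seq x} {seq x} (cauchy x))

0ᵣ 1ᵣ : ℝ
0ᵣ = mkℝ (λ _ → 0ℚ) (const-∼ 0ℚ)
1ᵣ = mkℝ (λ _ → 1ℚ) (const-∼ 1ℚ)

private
  ≈ᵣ-refl : ∀ {x} → x ≈ᵣ x
  ≈ᵣ-refl {x} = mk≈ (cauchy x)

  ≈ᵣ-sym : ∀ {x y} → x ≈ᵣ y → y ≈ᵣ x
  ≈ᵣ-sym {x} {y} p = mk≈ (∼-sym {seq x} {seq y} (seq-∼ p))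

  ≈ᵣ-trans : ∀ {x y z} → x ≈ᵣ y → y ≈ᵣ z → x ≈ᵣ z
  ≈ᵣ-trans {x} {y} {z} p q = mk≈ (∼-trans {seq x} {seq y} {seq z} (seq-∼ p) (seq-∼ q))

  +ᵣ-cong : ∀ {x x′ y y′} → x ≈ᵣ x′ → y ≈ᵣ y′ → x +ᵣ y ≈ᵣ x′ +ᵣ y′
  +ᵣ-cong {x} {x′} {y} {y′} p q =
    mk≈ (+-resp-∼ {seq x} {seq x′} {seq y} {seq y′} (seq-∼ p) (seq-∼ q))

  *ᵣ-cong : ∀ {x x′ y y′} → x ≈ᵣ x′ → y ≈ᵣ y′ → x *ᵣ y ≈ᵣ x′ *ᵣ y′
  *ᵣ-cong {x} {x′} {y} {y′} p q =
    mk≈ (*-resp-∼ {seq x} {seq x′} {seq y} {seq y′} (seq-∼ p) (seq-∼ q))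

  -ᵣ-cong : ∀ {x x′} → x ≈ᵣ x′ → -ᵣ x ≈ᵣ -ᵣ x′
  -ᵣ-cong {x} {x′} p = mk≈ (-‿resp-∼ {seq x} {seq x′} (seq-∼ p))

ℝ-commutativeRing : CommutativeRing 0ℓ 0ℓ
ℝ-commutativeRing = record
  { Carrier = ℝ ; _≈_ = _≈ᵣ_ ; _+_ = _+ᵣ_ ; _*_ = _*ᵣ_ ; -_ = -ᵣ_ ; 0# = 0ᵣ ; 1# = 1ᵣ
  ; isCommutativeRing = record
    { isRing = record
      { +-isAbelianGroup = record
        { isGroup = record
          { isMonoid = record
            { isSemigroup = record
              { isMagma = record
                { isEquivalence = record
                  { refl = ≈ᵣ-refl ; sym = ≈ᵣ-sym ; trans = ≈ᵣ-trans }
                ; ∙-cong = +ᵣ-cong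
                }
              ; assoc = λ x y z → ≗⇒≈ᵣ ((x +ᵣ y) +ᵣ z) (x +ᵣ (y +ᵣ z))
                  λ n → ℚ.+-assoc (seq x n) (seq y n) (seq z n)
              }
            ; identity = (λ x → ≗⇒≈ᵣ (0ᵣ +ᵣ x) x λ n → ℚ.+-identityˡ (seq x n))
                       , (λ x → ≗⇒≈ᵣ (x +ᵣ 0ᵣ) x λ n → ℚ.+-identityʳ (seq x n))
            }
          ; inverse = (λ x → ≗⇒≈ᵣ (-ᵣ x +ᵣ x) 0ᵣ λ n → ℚ.+-inverseˡ (seq x n))
                    , (λ x → ≗⇒≈ᵣ (x +ᵣ -ᵣ x) 0ᵣ λ n → ℚ.+-inverseʳ (seq x n))
          ; ⁻¹-cong = -ᵣ-cong
          }
        ; comm = λ x y → ≗⇒≈ᵣ (x +ᵣ y) (y +ᵣ x) λ n → ℚ.+-comm (seq x n) (seq y n)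
        }
      ; *-cong = *ᵣ-cong
      ; *-assoc = λ x y z → ≗⇒≈ᵣ ((x *ᵣ y) *ᵣ z) (x *ᵣ (y *ᵣ z))
          λ n → ℚ.*-assoc (seq x n) (seq y n) (seq z n)
      ; *-identity = (λ x → ≗⇒≈ᵣ (1ᵣ *ᵣ x) x λ n → ℚ.*-identityˡ (seq x n))
                   , (λ x → ≗⇒≈ᵣ (x *ᵣ 1ᵣ) x λ n → ℚ.*-identityʳ (seq x n))
      ; distrib = (λ x y z → ≗⇒≈ᵣ (x *ᵣ (y +ᵣ z)) (x *ᵣ y +ᵣ x *ᵣ z)
                    λ n → ℚ.*-distribˡ-+ (seq x n) (seq y n) (seq z n))
                , (λ x y z → ≗⇒≈ᵣ ((y +ᵣ z) *ᵣ x) (y *ᵣ x +ᵣ z *ᵣ x)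
                    λ n → ℚ.*-distribʳ-+ (seq x n) (seq y n) (seq z n))
      }
    ; *-comm = λ x y → ≗⇒≈ᵣ (x *ᵣ y) (y *ᵣ x) λ n → ℚ.*-comm (seq x n) (seq y n)
    }
  }

record ℂ : Set where
  constructor _+i_
  field
    re im : ℝ
open ℂ public

infix 4 _≈_
record _≈_ (z w : ℂ) : Set where
  constructor _+i≈_
  field
    re-≈ : re z ≈ᵣ re w
    im-≈ : im z ≈ᵣ im w

infixl 6 _+ℂ_
infixl 7 _*ℂ_

_+ℂ_ _*ℂ_ : ℂ → ℂ → ℂ
(a +i b) +ℂ (c +i d) = (a +ᵣ c) +i (b +ᵣ d)
(a +i b) *ℂ (c +i d) = (a *ᵣ c +ᵣ -ᵣ (b *ᵣ d)) +i (a *ᵣ d +ᵣ b *ᵣ c)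

ℂ-commutativeRing : CommutativeRing 0ℓ 0ℓ
ℂ-commutativeRing = record
  { Carrier = ℂ
  ; _≈_ = _≈_
  ; _+_ = _+ℂ_
  ; _*_ = _*ℂ_
  ; -_  = λ z → (-ᵣ re z) +i (-ᵣ im z)
  ; 0#  = 0ᵣ +i 0ᵣ
  ; 1#  = 1ᵣ +i 0ᵣ
  ; isCommutativeRing = record
    { isRing = record
      { +-isAbelianGroup = record
        { isGroup = record
          { isMonoid = record
            { isSemigroup = record
              { isMagma = record
                { isEquivalence = isEquivalence
                ; ∙-cong = λ (p +i≈ q) (r +i≈ s) → +ᵣ-cong p r +i≈ +ᵣ-cong q s
                }
              ; assoc = λ (a +i b) (c +i d) (e +i f) → R.+-assoc a c e +i≈ R.+-assoc b d f
              }
            ; identity = (λ (a +i b) → R.+-identityˡ a +i≈ R.+-identityˡ b)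
                       , (λ (a +i b) → R.+-identityʳ a +i≈ R.+-identityʳ b)
            }
          ; inverse = (λ (a +i b) → R.-‿inverseˡ a +i≈ R.-‿inverseˡ b)
                    , (λ (a +i b) → R.-‿inverseʳ a +i≈ R.-‿inverseʳ b)
          ; ⁻¹-cong = λ (p +i≈ q) → -ᵣ-cong p +i≈ -ᵣ-cong q
          }
        ; comm = λ (a +i b) (c +i d) → R.+-comm a c +i≈ R.+-comm b d
        }
      ; *-cong = *-cong
      ; *-assoc = *-assoc
      ; *-identity = comm∧idˡ⇒id *-comm *-identityˡ
      ; distrib = comm∧distrˡ⇒distr (λ (p +i≈ q) (r +i≈ s) → +ᵣ-cong p r +i≈ +ᵣ-cong q s)
                    *-comm *-distribˡ-+
      }
    ; *-comm = *-comm
    }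
  }
  where
  module R = CommutativeRing ℝ-commutativeRing

  isEquivalence : IsEquivalence _≈_
  isEquivalence = record
    { refl  = ≈ᵣ-refl +i≈ ≈ᵣ-refl
    ; sym   = λ (p +i≈ q) → ≈ᵣ-sym p +i≈ ≈ᵣ-sym q
    ; trans = λ (p +i≈ q) (r +i≈ s) → ≈ᵣ-trans p r +i≈ ≈ᵣ-trans q s
    }

  setoid : Setoid 0ℓ 0ℓ
  setoid = record { isEquivalence = isEquivalence }

  open Consequences setoid
    using (comm∧idˡ⇒id; comm∧distrˡ⇒distr)

  -- Multiplicative laws hold termwise, by ring normalisation in ℚ.
  termwise : ∀ z w → (∀ n → seq (re z) n ≡ seq (re w) n) →
             (∀ n → seq (im z) n ≡ seq (im w) n) → z ≈ w
  termwise z w p q = ≗⇒≈ᵣ (re z) (re w) p +i≈ ≗⇒≈ᵣ (im z) (im w) q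

  *-cong : ∀ {z z′ w w′} → z ≈ z′ → w ≈ w′ → z *ℂ w ≈ z′ *ℂ w′
  *-cong (p +i≈ q) (r +i≈ s) =
    +ᵣ-cong (*ᵣ-cong p r) (-ᵣ-cong (*ᵣ-cong q s)) +i≈
    +ᵣ-cong (*ᵣ-cong p s) (*ᵣ-cong q r)

  *-assoc : ∀ z w v → (z *ℂ w) *ℂ v ≈ z *ℂ (w *ℂ v)
  *-assoc z@(a +i b) w@(c +i d) v@(e +i f) = termwise ((z *ℂ w) *ℂ v) (z *ℂ (w *ℂ v))
    (λ n → solve 6 (λ a b c d e f →
      (a :* c :+ :- (b :* d)) :* e :+ :- ((a :* d :+ b :* c) :* f) :=
      a :* (c :* e :+ :- (d :* f)) :+ :- (b :* (c :* f :+ d :* e))) refl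
      (seq a n) (seq b n) (seq c n) (seq d n) (seq e n) (seq f n))
    (λ n → solve 6 (λ a b c d e f →
      (a :* c :+ :- (b :* d)) :* f :+ (a :* d :+ b :* c) :* e :=
      a :* (c :* f :+ d :* e) :+ b :* (c :* e :+ :- (d :* f))) refl
      (seq a n) (seq b n) (seq c n) (seq d n) (seq e n) (seq f n))

  *-comm : ∀ z w → z *ℂ w ≈ w *ℂ z
  *-comm z@(a +i b) w@(c +i d) = termwise (z *ℂ w) (w *ℂ z)
    (λ n → solve 4 (λ a b c d → a :* c :+ :- (b :* d) := c :* a :+ :- (d :* b)) refl
      (seq a n) (seq b n) (seq c n) (seq d n))
    (λ n → solve 4 (λ a b c d → a :* d :+ b :* c := c :* b :+ d :* a) refl
      (seq a n) (seq b n) (seq c n) (seq d n))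

  *-identityˡ : ∀ z → (1ᵣ +i 0ᵣ) *ℂ z ≈ z
  *-identityˡ z@(a +i b) = termwise ((1ᵣ +i 0ᵣ) *ℂ z) z
    (λ n → solve 2 (λ a b → con 1ℚ :* a :+ :- (con 0ℚ :* b) := a) refl (seq a n) (seq b n))
    (λ n → solve 2 (λ a b → con 1ℚ :* b :+ con 0ℚ :* a := b) refl (seq a n) (seq b n))

  *-distribˡ-+ : ∀ z w v → z *ℂ (w +ℂ v) ≈ z *ℂ w +ℂ z *ℂ v
  *-distribˡ-+ z@(a +i b) w@(c +i d) v@(e +i f) = termwise (z *ℂ (w +ℂ v)) (z *ℂ w +ℂ z *ℂ v)
    (λ n → solve 6 (λ a b c d e f →
      a :* (c :+ e) :+ :- (b :* (d :+ f)) :=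
      (a :* c :+ :- (b :* d)) :+ (a :* e :+ :- (b :* f))) refl
      (seq a n) (seq b n) (seq c n) (seq d n) (seq e n) (seq f n))
    (λ n → solve 6 (λ a b c d e f →
      a :* (d :+ f) :+ b :* (c :+ e) := (a :* d :+ b :* c) :+ (a :* f :+ b :* e)) refl
      (seq a n) (seq b n) (seq c n) (seq d n) (seq e n) (seq f n))

-- |z| = r, i.e. r is the non-negative square root of re(z)² + im(z)²
∣_∣≈_ : ℂ → ℝ → Set
∣ z ∣≈ r = 0ᵣ ≤ᵣ r × r *ᵣ r ≈ᵣ re z *ᵣ re z +ᵣ im z *ᵣ im z

record 𝕋 : Set where
  field
    value      : ℂ
    unimodular : ∣ value ∣≈ 1ᵣ

Matrix : ∀ {a} → Set a → ℕ → Set a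
Matrix A n = Fin n → Fin n → A

module _ {a ℓ} (R : RawRing a ℓ) where
  open RawRing R
  open RawSemiringOps rawSemiring using (sum; _^_)

  -- Cofactor expansion along the first row
  det : ∀ {n} → Matrix Carrier n → Carrier
  det {zero}  M = 1#
  det {suc n} M = sum λ j →
    (- 1#) ^ toℕ j * (M zero j * det (λ i k → M (suc i) (punchIn j k)))

-- A polynomial over R is its list of coefficients, constant term first;
-- trailing zeros are allowed, so polynomials are compared coefficientwise.
module Polynomial {a ℓ} (R : RawRing a ℓ) where
  private module R = RawRing R

  infix  4 _≈ₚ_
  infixl 6 _+ₚ_
  infixl 7 _*ₚ_

  Poly : Set a
  Poly = List R.Carrier

  coeff : Poly → ℕ → R.Carrier
  coeff []      _       = R.0#
  coeff (c ∷ p) zero    = c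
  coeff (c ∷ p) (suc k) = coeff p k

  _≈ₚ_ : Poly → Poly → Set ℓ
  p ≈ₚ q = ∀ k → coeff p k R.≈ coeff q k

  _+ₚ_ : Poly → Poly → Poly
  []      +ₚ q       = q
  p       +ₚ []      = p
  (c ∷ p) +ₚ (d ∷ q) = (c R.+ d) ∷ (p +ₚ q)

  _*ₚ_ : Poly → Poly → Poly
  []      *ₚ q = []
  (c ∷ p) *ₚ q = List.map (c R.*_) q +ₚ (R.0# ∷ p *ₚ q)

  C : R.Carrier → Poly
  C c = c ∷ []

  X : Poly
  X = R.0# ∷ R.1# ∷ []

  polyRing : RawRing a ℓ
  polyRing = record
    { Carrier = Poly
    ; _≈_     = _≈ₚ_
    ; _+_     = _+ₚ_
    ; _*_     = _*ₚ_
    ; -_      = List.map R.-_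
    ; 0#      = []
    ; 1#      = C R.1#
    }

  open RawSemiringOps (RawRing.rawSemiring polyRing) public using (sum; _^_)

  identity : ∀ {n} → Matrix Poly n
  identity i j = if does (i Fin.≟ j) then RawRing.1# polyRing else RawRing.0# polyRing

  -- det(X I - M), computed in R[X]
  charPoly : ∀ {n} → Matrix R.Carrier n → Poly
  charPoly M = det polyRing λ i j → (X * identity i j) + (- C (M i j))
    where open RawRing polyRing

-- An arc set is stored as the vector of the out-neighbourhoods of the vertices.
ArcSet : ℕ → Set
ArcSet n = Vec (Subset n) n

module _ {n : ℕ} where

  outN : ArcSet n → Fin n → Subset n
  outN 𝒜 i = lookup 𝒜 i

  inN : ArcSet n → Fin n → Subset n
  inN 𝒜 j = Vec.map (λ out → lookup out j) 𝒜

  Arc : ArcSet n → Fin n → Fin n → Set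
  Arc 𝒜 i j = j ∈ outN 𝒜 i

  arc? : ∀ 𝒜 i j → Dec (Arc 𝒜 i j)
  arc? 𝒜 i j = j ∈? outN 𝒜 i

record Digraph (n : ℕ) : Set where
  field
    arcs     : ArcSet n
    loopless : ∀ i → i ∉ outN arcs i

vectors : ∀ {a} {A : Set a} → List A → ∀ n → List (Vec A n)
vectors xs zero    = [] ∷ []
vectors xs (suc n) = List.cartesianProductWith _∷_ xs (vectors xs n)

module _ {n : ℕ} where

  -- A directed cycle is listed by its vertices, in the order in which they are
  -- traversed and starting from the least one; this selects exactly one of its
  -- rotations.  Without loops, its length is automatically at least 2.
  IsDirectedCycle : ArcSet n → List (Fin n) → Set
  IsDirectedCycle 𝒜 []       = Empty
  IsDirectedCycle 𝒜 (v ∷ vs) =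
    All (v Fin.<_) vs × Unique (v ∷ vs) × Linked (Arc 𝒜) (v ∷ vs ∷ʳ v)

  isDirectedCycle? : ∀ 𝒜 vs → Dec (IsDirectedCycle 𝒜 vs)
  isDirectedCycle? 𝒜 []       = no λ ()
  isDirectedCycle? 𝒜 (v ∷ vs) =
    all? (v Fin.<?_) vs ×-dec DecUnique.unique? Fin._≟_ (v ∷ vs)
      ×-dec linked? (arc? 𝒜) (v ∷ vs ∷ʳ v)

  -- A directed cycle has distinct vertices, hence length at most n.
  directedCycles : ArcSet n → List (List (Fin n))
  directedCycles 𝒜 = List.filter (isDirectedCycle? 𝒜)
    (List.concatMap (λ l → List.map Vec.toList (vectors (List.allFin n) l))
                    (List.upTo (suc n)))

record Subgraph (n : ℕ) : Set where
  constructor subgraph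
  field
    verts : Subset n
    arcs  : ArcSet n

module _ {n : ℕ} where

  allSubgraphs : List (Subgraph n)
  allSubgraphs = List.cartesianProductWith subgraph subsets (vectors subsets n)
    where
    subsets : List (Subset n)
    subsets = vectors (outside ∷ inside ∷ []) n

  module _ (D : Digraph n) (E : Subgraph n) where
    private
      module D = Digraph D
      module E = Subgraph E

    IsSubdigraph : Set
    IsSubdigraph = ∀ i j → Arc E.arcs i j → Arc D.arcs i j × i ∈ E.verts × j ∈ E.verts

    IsElementary : Set
    IsElementary = IsSubdigraph ×
      (∀ v → v ∈ E.verts → ∣ outN E.arcs v ∣ ≡ 1 × ∣ inN E.arcs v ∣ ≡ 1)

    isElementary? : Dec IsElementary
    isElementary? =
      Fin.all? (λ i → Fin.all? λ j →
        arc? E.arcs i j →-dec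
          (arc? D.arcs i j ×-dec (i ∈? E.verts) ×-dec (j ∈? E.verts)))
      ×-dec
      Fin.all? (λ v → (v ∈? E.verts) →-dec
        ((∣ outN E.arcs v ∣ ℕ.≟ 1) ×-dec (∣ inN E.arcs v ∣ ℕ.≟ 1)))

  𝓔 : ℕ → Digraph n → List (Subgraph n)
  𝓔 k D = List.filter
    (λ E → isElementary? D E ×-dec (∣ Subgraph.verts E ∣ ℕ.≟ k)) allSubgraphs

  -- The directed cycles composing an elementary E are the directed cycles of E.
  c : Subgraph n → ℕ
  c E = List.length (directedCycles (Subgraph.arcs E))

ℂ-ring : RawRing 0ℓ 0ℓ
ℂ-ring = CommutativeRing.rawRing ℂ-commutativeRing

open RawRing ℂ-ring
open RawSemiringOps (RawRing.rawSemiring ℂ-ring) using (_^_)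

record 𝕋GainDigraph (n : ℕ) : Set where
  field
    digraph : Digraph n
  open Digraph digraph public
  field
    φ : ∀ {i j} → Arc arcs i j → 𝕋

module _ {n : ℕ} (Φ : 𝕋GainDigraph n) where
  open 𝕋GainDigraph Φ

  gainAdjacency : Matrix ℂ n
  gainAdjacency i j with arc? arcs i j
  ... | yes ij = 𝕋.value (φ ij)
  ... | no  _  = 0#

  -- On an arc of the digraph, the entry of the gain adjacency matrix is its gain;
  -- off the arcs the value is irrelevant, as the sum a only involves walks in it.
  walkGain : List (Fin n) → ℂ
  walkGain (u ∷ v ∷ vs) = gainAdjacency u v * walkGain (v ∷ vs)
  walkGain _            = 1#

  cycleGain : List (Fin n) → ℂ
  cycleGain []       = 1#
  cycleGain (v ∷ vs) = walkGain (v ∷ vs ∷ʳ v)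

  gain : Subgraph n → ℂ
  gain E = List.foldr _*_ 1# (List.map cycleGain (directedCycles (Subgraph.arcs E)))

  a : ℕ → ℂ
  a zero      = 1#
  a k@(suc _) = List.foldr _+_ 0# (List.map (λ E → (- 1#) ^ c E * gain E) (𝓔 k digraph))

-- Expanding det (X I - A) over permutations σ, and using that A vanishes on the
-- diagonal, the surviving product of σ is X to the number of fixed points times
-- the product of the entries - A i (σ i) over the moved points i; it vanishes
-- unless σ moves points along arcs only.  Such σ correspond to elementary
-- subdigraphs, with the moved points as vertices and the arcs i ⟶ σ i.  A cycle of
-- length l contributes (-1)^(l-1) to the sign of σ and (-1)^l through its entries,
-- so each directed cycle carries exactly one sign.
--
-- Permutations are given by their Lehmer codes, along which the cofactor expansion
-- of the determinant unfolds.

module Submission where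

open import Defs hiding (_≈_) renaming (c to numCycles)
open import Algebra.Bundles using (RawRing; CommutativeMonoid; CommutativeRing)
import Algebra.Definitions.RawSemiring as RawSemiringOps
import Algebra.Properties.CommutativeSemigroup as CommutativeSemigroupProperties
import Algebra.Properties.Ring as RingProperties
open import Data.Bool.Base using (Bool; true; false; not; if_then_else_)
open import Data.Empty using (⊥)
open import Data.Fin.Base as Fin using (Fin; zero; suc; toℕ; punchIn; punchOut)
import Data.Fin.Induction as Fin
import Data.Fin.Properties as Fin
open import Data.Fin.Subset using (Subset; ⁅_⁆; inside; outside; ∣_∣)
  renaming (_∈_ to _∈ₛ_; _∉_ to _∉ₛ_; ⊥ to ∅)
import Data.Fin.Subset.Properties as Subset
open import Data.List.Base as List
  using (List; []; _∷_; _++_; _∷ʳ_; map; foldr; filter; concat; cartesianProductWith; allFin)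
open import Data.List.Membership.Propositional using (_∈_; _∉_; find)
open import Data.List.Membership.Propositional.Properties
  using ( ∈-lookup; ∈-cartesianProductWith⁺; ∈-map⁺; ∈-map⁻; ∈-filter⁺; ∈-filter⁻; ∈-concat⁺′
        ; ∈-concat⁻′; ∈-upTo⁺; ∈-allFin; ∈-++⁺ʳ; ∈-++⁻; ∈-∃++)
open import Data.List.Membership.Propositional.Properties.WithK using (unique∧set⇒bag)
open import Data.List.Properties using (length-++; ++-assoc; map-cong; map-tabulate; map-∘)
open import Data.List.Relation.Binary.BagAndSetEquality using (∼bag⇒↭)
open import Data.List.Relation.Binary.Disjoint.Propositional using (Disjoint)
open import Data.List.Relation.Binary.Permutation.Propositional as ↭ using (_↭_)
open import Data.List.Relation.Unary.All as All using (All; []; _∷_)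
import Data.List.Relation.Unary.All.Properties as All
open import Data.List.Relation.Unary.AllPairs as AllPairs using (AllPairs; []; _∷_)
import Data.List.Relation.Unary.AllPairs.Properties as AllPairs
open import Data.List.Relation.Unary.Any using (here; there)
open import Data.List.Relation.Unary.Linked as Linked using (Linked; [-]; _∷_)
open import Data.List.Relation.Unary.Unique.Propositional using (Unique)
import Data.List.Relation.Unary.Unique.Propositional.Properties as Unique
open import Data.Nat.Base as ℕ using (ℕ; zero; suc; _∸_; s≤s)
import Data.Nat.Properties as ℕ
open import Data.Product.Base using (∃; _×_; _,_; proj₁; proj₂)
open import Data.Sum.Base using (_⊎_; inj₁; inj₂)
open import Data.Vec.Base as Vec using (Vec; []; _∷_)
import Data.Vec.Properties as Vec
open import Function.Base using (_∘_; id)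
open import Function.Bundles using (mk⇔)
open import Induction.WellFounded using (Acc; acc)
open import Relation.Binary.PropositionalEquality as ≡ using (_≡_; _≢_; refl)
import Relation.Binary.Reasoning.Setoid as ≈-Reasoning
open import Relation.Nullary using (¬_; yes; no; contradiction)
open import Relation.Nullary.Decidable using (Dec; does; ¬?; _×-dec_; _→-dec_; decidable-stable)
open import Relation.Unary using (Pred; Decidable)

-- The elementary subdigraphs and the directed cycles are given by filtering large enumerations.
-- These are never evaluated: two lists without repetition and with the same members are
-- rearrangements of each other, and sums and products ignore the order. Both the correspondence
-- with permutations and the partition of the moved points into cycles are used in this form.
--
-- The main obstacle is the sign. On a Lehmer code it is a product of cofactor signs, which says
-- nothing about cycles. The bridge is that exchanging two values of a permutation negates it: at
-- the first two positions this compares two digits, and all other exchanges follow by recursion and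
-- conjugation. A cycle is dismantled by such exchanges, each turning one of its vertices into a
-- fixed point.
--
-- The other obstacle is that an elementary subdigraph carries no list of its cycles; they have to
-- be found. The orbit of a moved point is followed up to its first return, which exists by
-- finiteness and injectivity, and the rotation starting at the least vertex is the one enumerated.

module BigOperator {c ℓ} (M : CommutativeMonoid c ℓ) where
  open CommutativeMonoid M renaming (refl to ≈-refl; sym to ≈-sym; trans to ≈-trans)
  open CommutativeSemigroupProperties commutativeSemigroup using (interchange; x∙yz≈y∙xz)
  open ≈-Reasoning setoid

  module _ {a} {A : Set a} where

    ⨁ : (A → Carrier) → List A → Carrier
    ⨁ f xs = foldr _∙_ ε (map f xs)

    ⨁-cong-∈ : ∀ {f g} xs → (∀ {x} → x ∈ xs → f x ≈ g x) → ⨁ f xs ≈ ⨁ g xs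
    ⨁-cong-∈ []       f≈g = ≈-refl
    ⨁-cong-∈ (x ∷ xs) f≈g = ∙-cong (f≈g (here refl)) (⨁-cong-∈ xs (f≈g ∘ there))

    ⨁-cong : ∀ {f g} → (∀ x → f x ≈ g x) → ∀ xs → ⨁ f xs ≈ ⨁ g xs
    ⨁-cong f≈g xs = ⨁-cong-∈ xs λ {x} _ → f≈g x

    ⨁-identity : ∀ {f} xs → (∀ {x} → x ∈ xs → f x ≈ ε) → ⨁ f xs ≈ ε
    ⨁-identity []       f≈ε = ≈-refl
    ⨁-identity (x ∷ xs) f≈ε =
      ≈-trans (∙-cong (f≈ε (here refl)) (⨁-identity xs (f≈ε ∘ there))) (identityˡ ε)

    ⨁-distrib-∙ : ∀ f g xs → ⨁ (λ x → f x ∙ g x) xs ≈ ⨁ f xs ∙ ⨁ g xs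
    ⨁-distrib-∙ f g []       = ≈-sym (identityˡ ε)
    ⨁-distrib-∙ f g (x ∷ xs) =
      ≈-trans (∙-congˡ (⨁-distrib-∙ f g xs)) (interchange _ _ _ _)

    ⨁-++ : ∀ f xs ys → ⨁ f (xs ++ ys) ≈ ⨁ f xs ∙ ⨁ f ys
    ⨁-++ f []       ys = ≈-sym (identityˡ _)
    ⨁-++ f (x ∷ xs) ys = ≈-trans (∙-congˡ (⨁-++ f xs ys)) (≈-sym (assoc _ _ _))

    ⨁-↭ : ∀ f {xs ys} → xs ↭ ys → ⨁ f xs ≈ ⨁ f ys
    ⨁-↭ f ↭.refl          = ≈-refl
    ⨁-↭ f (↭.prep x p)    = ∙-congˡ (⨁-↭ f p)
    ⨁-↭ f (↭.swap x y p)  = ≈-trans (∙-congˡ (∙-congˡ (⨁-↭ f p))) (x∙yz≈y∙xz _ _ _)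
    ⨁-↭ f (↭.trans p q)   = ≈-trans (⨁-↭ f p) (⨁-↭ f q)

    ⨁-filter : ∀ {p} {P : Pred A p} (P? : Decidable P) {f} →
               (∀ x → ¬ P x → f x ≈ ε) → ∀ xs → ⨁ f xs ≈ ⨁ f (filter P? xs)
    ⨁-filter P? f≈ε []       = ≈-refl
    ⨁-filter P? f≈ε (x ∷ xs) with P? x
    ... | yes _  = ∙-congˡ (⨁-filter P? f≈ε xs)
    ... | no ¬Px = ≈-trans (∙-cong (f≈ε x ¬Px) (⨁-filter P? f≈ε xs)) (identityˡ _)

  ⨁-concat : ∀ {a} {A : Set a} (f : A → Carrier) xss → ⨁ f (concat xss) ≈ ⨁ (⨁ f) xss
  ⨁-concat f []         = ≈-refl
  ⨁-concat f (xs ∷ xss) = ≈-trans (⨁-++ f xs (concat xss)) (∙-congˡ (⨁-concat f xss))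

  ⨁-map : ∀ {a b} {A : Set a} {B : Set b} (f : B → Carrier) (g : A → B) xs →
          ⨁ f (map g xs) ≡ ⨁ (f ∘ g) xs
  ⨁-map f g xs = ≡.cong (foldr _∙_ ε) (≡.sym (map-∘ xs))

  ⨁-cartesianProductWith :
    ∀ {a b d} {A : Set a} {B : Set b} {D : Set d} (f : D → Carrier) (g : A → B → D) xs ys →
    ⨁ f (cartesianProductWith g xs ys) ≈ ⨁ (λ x → ⨁ (λ y → f (g x y)) ys) xs
  ⨁-cartesianProductWith f g []       ys = ≈-refl
  ⨁-cartesianProductWith f g (x ∷ xs) ys = begin
    ⨁ f (map (g x) ys ++ cartesianProductWith g xs ys)
      ≈⟨ ⨁-++ f (map (g x) ys) _ ⟩
    ⨁ f (map (g x) ys) ∙ ⨁ f (cartesianProductWith g xs ys)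
      ≈⟨ ∙-cong (reflexive (⨁-map f (g x) ys)) (⨁-cartesianProductWith f g xs ys) ⟩
    ⨁ (f ∘ g x) ys ∙ ⨁ (λ x → ⨁ (λ y → f (g x y)) ys) xs
      ∎

  ⨁-allFin-suc : ∀ {n} (f : Fin (suc n) → Carrier) →
                 ⨁ f (allFin (suc n)) ≡ f zero ∙ ⨁ (f ∘ suc) (allFin n)
  ⨁-allFin-suc f = ≡.cong (λ xs → f zero ∙ foldr _∙_ ε xs)
    (≡.trans (map-tabulate suc f) (≡.sym (map-tabulate id (f ∘ suc))))

-- Permutations as Lehmer codes

infixr 5 _∷_

-- The Lehmer code of a permutation: the value at 0, followed by the code of the
-- remaining values, renumbered in increasing order.
data Code : ℕ → Set where
  []  : Code 0
  _∷_ : ∀ {n} → Fin (suc n) → Code n → Code (suc n)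

decode : ∀ {n} → Code n → Fin n → Fin n
decode (j ∷ c) zero    = j
decode (j ∷ c) (suc i) = punchIn j (decode c i)

codes : ∀ n → List (Code n)
codes zero    = [] ∷ []
codes (suc n) = cartesianProductWith _∷_ (allFin (suc n)) (codes n)

module _ {n : ℕ} (f : Fin n → Fin n) where

  Step : Fin n → Fin n → Set
  Step i j = f i ≡ j

  -- Neither a least first vertex nor length at least 2 is asked for: a cycle that loses its
  -- vertices one at a time has to be able to end as a fixed point.
  ClosedWalk : List (Fin n) → Set
  ClosedWalk []       = ⊥
  ClosedWalk (v ∷ vs) = Linked Step (v ∷ vs ∷ʳ v)

module Σℕ = BigOperator ℕ.+-0-commutativeMonoid renaming (⨁ to Σ)

module RingTheory {a ℓ} (R : CommutativeRing a ℓ) where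
  open CommutativeRing R hiding (zero)
    renaming (refl to ≈-refl; sym to ≈-sym; trans to ≈-trans)
  open RawSemiringOps (RawRing.rawSemiring rawRing) using (_^_)
  open RingProperties ring
  open CommutativeSemigroupProperties *-commutativeSemigroup
    using (interchange; x∙yz≈y∙xz)
  open ≈-Reasoning setoid
  module Sum = BigOperator +-commutativeMonoid renaming (⨁ to Σ)
  module Product = BigOperator *-commutativeMonoid renaming (⨁ to Π)
  open Sum public using (Σ)
  open Product public using (Π)

  *-distribˡ-Σ : ∀ {b} {B : Set b} x (f : B → Carrier) ys →
                 x * Σ f ys ≈ Σ (λ y → x * f y) ys
  *-distribˡ-Σ x f []       = zeroʳ x
  *-distribˡ-Σ x f (y ∷ ys) = ≈-trans (distribˡ x _ _) (+-congˡ (*-distribˡ-Σ x f ys))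

  Π-zero : ∀ {b} {B : Set b} (f : B → Carrier) {x xs} → x ∈ xs → f x ≈ 0# → Π f xs ≈ 0#
  Π-zero f (here refl)  fx≈0 = ≈-trans (*-congʳ fx≈0) (zeroˡ _)
  Π-zero f (there x∈xs) fx≈0 = ≈-trans (*-congˡ (Π-zero f x∈xs fx≈0)) (zeroʳ _)

  -- The digit `j` counts the later positions with a smaller value, so the exponents add up to the
  -- number of inversions.
  sgn : ∀ {n} → Code n → Carrier
  sgn []      = 1#
  sgn (j ∷ c) = (- 1#) ^ toℕ j * sgn c

  -- Coefficients of polynomials and multiplication by monomials

  open Polynomial rawRing using (Poly; coeff; _+ₚ_; _*ₚ_; polyRing; X; C; charPoly; identity)
    renaming (sum to sumₚ; _^_ to _^ₚ_)

  coeff-+ : ∀ p q m → coeff (p +ₚ q) m ≈ coeff p m + coeff q m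
  coeff-+ []      q       m       = ≈-sym (+-identityˡ _)
  coeff-+ (x ∷ p) []      m       = ≈-sym (+-identityʳ _)
  coeff-+ (x ∷ p) (y ∷ q) zero    = ≈-refl
  coeff-+ (x ∷ p) (y ∷ q) (suc m) = coeff-+ p q m

  coeff-scale : ∀ x q m → coeff (map (x *_) q) m ≈ x * coeff q m
  coeff-scale x []      m       = ≈-sym (zeroʳ x)
  coeff-scale x (y ∷ q) zero    = ≈-refl
  coeff-scale x (y ∷ q) (suc m) = coeff-scale x q m

  coeff-sum : ∀ {n} (f : Fin n → Poly) m →
              coeff (sumₚ f) m ≈ Σ (λ j → coeff (f j) m) (allFin n)
  coeff-sum {zero}  f m = ≈-refl
  coeff-sum {suc n} f m = begin
    coeff (f zero +ₚ sumₚ (f ∘ suc)) m                            ≈⟨ coeff-+ (f zero) _ m ⟩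
    coeff (f zero) m + coeff (sumₚ (f ∘ suc)) m                   ≈⟨ +-congˡ (coeff-sum (f ∘ suc) m) ⟩
    coeff (f zero) m + Σ (λ j → coeff (f (suc j)) m) (allFin n)   ≡⟨ Sum.⨁-allFin-suc (λ j → coeff (f j) m) ⟨
    Σ (λ j → coeff (f j) m) (allFin (suc n))                      ∎

  -- The coefficient sequence of X^e times a polynomial with coefficient sequence `s`.
  shift : ℕ → (ℕ → Carrier) → ℕ → Carrier
  shift zero    s m       = s m
  shift (suc e) s zero    = 0#
  shift (suc e) s (suc m) = shift e s m

  shift-cong : ∀ e {s t} → (∀ m → s m ≈ t m) → ∀ m → shift e s m ≈ shift e t m
  shift-cong zero    s≈t m       = s≈t m
  shift-cong (suc e) s≈t zero    = ≈-refl
  shift-cong (suc e) s≈t (suc m) = shift-cong e s≈t m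

  shift-Σ : ∀ {b} {B : Set b} e (s : B → ℕ → Carrier) ys m →
            shift e (λ m → Σ (λ y → s y m) ys) m ≈ Σ (λ y → shift e (s y) m) ys
  shift-Σ zero    s ys m       = ≈-refl
  shift-Σ (suc e) s ys zero    = ≈-sym (Sum.⨁-identity ys λ _ → ≈-refl)
  shift-Σ (suc e) s ys (suc m) = shift-Σ e s ys m

  constant : Carrier → ℕ → Carrier
  constant x zero    = x
  constant x (suc _) = 0#

  monomial : ℕ → Carrier → ℕ → Carrier
  monomial e x = shift e (constant x)

  monomial-cong : ∀ e {x y} → x ≈ y → ∀ m → monomial e x m ≈ monomial e y m
  monomial-cong e {x} {y} x≈y = shift-cong e λ { zero → x≈y ; (suc _) → ≈-refl }

  monomial-0 : ∀ e m → monomial e 0# m ≈ 0#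
  monomial-0 zero    zero    = ≈-refl
  monomial-0 zero    (suc m) = ≈-refl
  monomial-0 (suc e) zero    = ≈-refl
  monomial-0 (suc e) (suc m) = monomial-0 e m

  monomial-≡ : ∀ m x → monomial m x m ≡ x
  monomial-≡ zero    x = refl
  monomial-≡ (suc m) x = monomial-≡ m x

  monomial-≢ : ∀ {e m} x → e ≢ m → monomial e x m ≡ 0#
  monomial-≢ {zero}  {zero}  x e≢m = contradiction refl e≢m
  monomial-≢ {zero}  {suc m} x e≢m = refl
  monomial-≢ {suc e} {zero}  x e≢m = refl
  monomial-≢ {suc e} {suc m} x e≢m = monomial-≢ {e} {m} x (e≢m ∘ ≡.cong suc)

  shift-0 : ∀ e {s} → (∀ m → s m ≈ 0#) → ∀ m → shift e s m ≈ 0#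
  shift-0 zero    s≈0 m       = s≈0 m
  shift-0 (suc e) s≈0 zero    = ≈-refl
  shift-0 (suc e) s≈0 (suc m) = shift-0 e s≈0 m

  scale-shift-monomial : ∀ e x d y m →
    shift e (λ m → x * monomial d y m) m ≈ monomial (e ℕ.+ d) (x * y) m
  scale-shift-monomial zero x zero    y zero    = ≈-refl
  scale-shift-monomial zero x zero    y (suc m) = zeroʳ x
  scale-shift-monomial zero x (suc d) y zero    = zeroʳ x
  scale-shift-monomial zero x (suc d) y (suc m) = scale-shift-monomial zero x d y m
  scale-shift-monomial (suc e) x d y zero    = ≈-refl
  scale-shift-monomial (suc e) x d y (suc m) = scale-shift-monomial e x d y m

  -- Every product below has a monomial as its left factor, which spares the ring
  -- laws for polynomials.
  IsMonomial : ℕ → Carrier → Poly → Set ℓ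
  IsMonomial e x p = ∀ m → coeff p m ≈ monomial e x m

  -- Trailing zeros are allowed, so a polynomial with vanishing coefficients may be a nonempty list,
  -- and its product need not reduce to `[]`.
  *ₚ-zero : ∀ p q → (∀ m → coeff p m ≈ 0#) → ∀ m → coeff (p *ₚ q) m ≈ 0#
  *ₚ-zero []      q p≈0 m = ≈-refl
  *ₚ-zero (x ∷ p) q p≈0 m = begin
    coeff (map (x *_) q +ₚ (0# ∷ p *ₚ q)) m            ≈⟨ coeff-+ (map (x *_) q) _ m ⟩
    coeff (map (x *_) q) m + coeff (0# ∷ p *ₚ q) m     ≈⟨ +-cong (coeff-scale x q m) (tail m) ⟩
    x * coeff q m + 0#                                 ≈⟨ +-identityʳ _ ⟩
    x * coeff q m                                      ≈⟨ *-congʳ (p≈0 zero) ⟩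
    0# * coeff q m                                     ≈⟨ zeroˡ _ ⟩
    0#                                                 ∎
    where
    tail : ∀ m → coeff (0# ∷ p *ₚ q) m ≈ 0#
    tail zero    = ≈-refl
    tail (suc m) = *ₚ-zero p q (p≈0 ∘ suc) m

  monomial-*ₚ : ∀ e x p q → IsMonomial e x p →
                ∀ m → coeff (p *ₚ q) m ≈ shift e (λ m → x * coeff q m) m
  -- The empty list is a monomial only with coefficient zero, which is read off at degree `e`.
  monomial-*ₚ e x [] q p≈ m = ≈-sym (shift-0 e (λ m → ≈-trans (*-congʳ x≈0) (zeroˡ _)) m)
    where
    x≈0 : x ≈ 0#
    x≈0 = ≈-trans (reflexive (≡.sym (monomial-≡ e x))) (≈-sym (p≈ e))
  monomial-*ₚ zero x (y ∷ p) q p≈ m = begin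
    coeff (map (y *_) q +ₚ (0# ∷ p *ₚ q)) m            ≈⟨ coeff-+ (map (y *_) q) _ m ⟩
    coeff (map (y *_) q) m + coeff (0# ∷ p *ₚ q) m     ≈⟨ +-cong (coeff-scale y q m) (tail m) ⟩
    y * coeff q m + 0#                                 ≈⟨ +-identityʳ _ ⟩
    y * coeff q m                                      ≈⟨ *-congʳ (p≈ zero) ⟩
    x * coeff q m                                      ∎
    where
    tail : ∀ m → coeff (0# ∷ p *ₚ q) m ≈ 0#
    tail zero    = ≈-refl
    tail (suc m) = *ₚ-zero p q (p≈ ∘ suc) m
  monomial-*ₚ (suc e) x (y ∷ p) q p≈ m = begin
    coeff (map (y *_) q +ₚ (0# ∷ p *ₚ q)) m            ≈⟨ coeff-+ (map (y *_) q) _ m ⟩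
    coeff (map (y *_) q) m + coeff (0# ∷ p *ₚ q) m     ≈⟨ +-congʳ (coeff-scale y q m) ⟩
    y * coeff q m + coeff (0# ∷ p *ₚ q) m              ≈⟨ +-congʳ (≈-trans (*-congʳ (p≈ zero)) (zeroˡ _)) ⟩
    0# + coeff (0# ∷ p *ₚ q) m                         ≈⟨ +-identityˡ _ ⟩
    coeff (0# ∷ p *ₚ q) m                              ≈⟨ tail m ⟩
    shift (suc e) (λ m → x * coeff q m) m              ∎
    where
    tail : ∀ m → coeff (0# ∷ p *ₚ q) m ≈ shift (suc e) (λ m → x * coeff q m) m
    tail zero    = ≈-refl
    tail (suc m) = monomial-*ₚ e x p q (p≈ ∘ suc) m

  *ₚ-monomial : ∀ {d e x y p q} → IsMonomial d x p → IsMonomial e y q →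
                IsMonomial (d ℕ.+ e) (x * y) (p *ₚ q)
  *ₚ-monomial {d} {e} {x} {y} {p} {q} p≈ q≈ m =
    ≈-trans (monomial-*ₚ d x p q p≈ m)
      (≈-trans (shift-cong d (*-congˡ ∘ q≈) m) (scale-shift-monomial d x e y m))

  C-monomial : ∀ x → IsMonomial 0 x (C x)
  C-monomial x zero    = ≈-refl
  C-monomial x (suc m) = ≈-refl

  X-monomial : IsMonomial 1 1# X
  X-monomial zero          = ≈-refl
  X-monomial (suc zero)    = ≈-refl
  X-monomial (suc (suc m)) = ≈-refl

  X^-monomial : ∀ k → IsMonomial k 1# (X ^ₚ k)
  X^-monomial zero    m = C-monomial 1# m
  X^-monomial (suc k) m = ≈-trans
    (*ₚ-monomial {1} {k} {p = X} {X ^ₚ k} X-monomial (X^-monomial k) m)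
    (monomial-cong (suc k) (*-identityˡ 1#) m)

  -1^-monomial : ∀ k → IsMonomial 0 ((- 1#) ^ k) (C (- 1#) ^ₚ k)
  -1^-monomial zero    = C-monomial 1#
  -1^-monomial (suc k) =
    *ₚ-monomial {0} {0} {p = C (- 1#)} {C (- 1#) ^ₚ k} (C-monomial (- 1#)) (-1^-monomial k)

  -- The minor at column `j` is indexed through `punchIn j`, the renumbering used by `decode`, so
  -- the induction hypothesis applies with no change of indices. As every entry is a monomial,
  -- degrees add and coefficients multiply along a code.
  det-monomials : ∀ {n} (M : Matrix Poly n) (e : Matrix ℕ n) (w : Matrix Carrier n) →
    (∀ i j → IsMonomial (e i j) (w i j) (M i j)) → ∀ m →
    coeff (det polyRing M) m ≈
    Σ (λ c → monomial (Σℕ.Σ (λ i → e i (decode c i)) (allFin n))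
                      (sgn c * Π (λ i → w i (decode c i)) (allFin n)) m)
      (codes n)
  det-monomials {zero}  M e w M≈ m = begin
    coeff (C 1#) m                      ≈⟨ C-monomial 1# m ⟩
    monomial 0 1# m                     ≈⟨ monomial-cong 0 (*-identityˡ 1#) m ⟨
    monomial 0 (1# * 1#) m              ≈⟨ +-identityʳ _ ⟨
    monomial 0 (1# * 1#) m + 0#         ∎
  det-monomials {suc n} M e w M≈ m = begin
    coeff (det polyRing M) m
      ≈⟨ coeff-sum (λ j → (C (- 1#) ^ₚ toℕ j) *ₚ (M zero j *ₚ minor j)) m ⟩
    Σ (λ j → coeff ((C (- 1#) ^ₚ toℕ j) *ₚ (M zero j *ₚ minor j)) m) (allFin (suc n))
      ≈⟨ Sum.⨁-cong term (allFin (suc n)) ⟩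
    Σ (λ j → Σ (λ c → summand (j ∷ c)) (codes n)) (allFin (suc n))
      ≈⟨ Sum.⨁-cartesianProductWith summand _∷_ (allFin (suc n)) (codes n) ⟨
    Σ summand (codes (suc n)) ∎
    where
    minor : Fin (suc n) → Poly
    minor j = det polyRing λ i k → M (suc i) (punchIn j k)

    E : ∀ j → Code n → ℕ
    E j c = Σℕ.Σ (λ i → e (suc i) (punchIn j (decode c i))) (allFin n)

    W : ∀ j → Code n → Carrier
    W j c = Π (λ i → w (suc i) (punchIn j (decode c i))) (allFin n)

    summand : Code (suc n) → Carrier
    summand c = monomial (Σℕ.Σ (λ i → e i (decode c i)) (allFin (suc n)))
                         (sgn c * Π (λ i → w i (decode c i)) (allFin (suc n))) m

    summand-∷ : ∀ j c → (- 1#) ^ toℕ j *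
                shift (e zero j) (λ m → w zero j * monomial (E j c) (sgn c * W j c) m) m
                ≈ summand (j ∷ c)
    summand-∷ j c = begin
      s * shift (e zero j) (λ m → w zero j * monomial (E j c) (sgn c * W j c) m) m
        ≈⟨ *-congˡ (scale-shift-monomial (e zero j) (w zero j) (E j c) _ m) ⟩
      s * monomial (e zero j ℕ.+ E j c) (w zero j * (sgn c * W j c)) m
        ≈⟨ scale-shift-monomial 0 s (e zero j ℕ.+ E j c) _ m ⟩
      monomial (e zero j ℕ.+ E j c) (s * (w zero j * (sgn c * W j c))) m
        ≈⟨ monomial-cong (e zero j ℕ.+ E j c) (≈-trans (*-congˡ (x∙yz≈y∙xz _ _ _)) (≈-sym (*-assoc _ _ _))) m ⟩
      monomial (e zero j ℕ.+ E j c) (sgn (j ∷ c) * (w zero j * W j c)) m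
        ≡⟨ ≡.cong₂ (λ d y → monomial d (sgn (j ∷ c) * y) m)
             (Σℕ.⨁-allFin-suc (λ i → e i (decode (j ∷ c) i)))
             (Product.⨁-allFin-suc (λ i → w i (decode (j ∷ c) i))) ⟨
      summand (j ∷ c) ∎
      where
      s : Carrier
      s = (- 1#) ^ toℕ j

    term : ∀ j → coeff ((C (- 1#) ^ₚ toℕ j) *ₚ (M zero j *ₚ minor j)) m ≈
                 Σ (λ c → summand (j ∷ c)) (codes n)
    term j = begin
      coeff ((C (- 1#) ^ₚ toℕ j) *ₚ (M zero j *ₚ minor j)) m
        ≈⟨ monomial-*ₚ 0 s (C (- 1#) ^ₚ toℕ j) (M zero j *ₚ minor j) (-1^-monomial (toℕ j)) m ⟩
      s * coeff (M zero j *ₚ minor j) m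
        ≈⟨ *-congˡ (monomial-*ₚ (e zero j) (w zero j) (M zero j) (minor j) (M≈ zero j) m) ⟩
      s * shift (e zero j) (λ m → w zero j * coeff (minor j) m) m
        ≈⟨ *-congˡ (shift-cong (e zero j) (λ m → *-congˡ (det-monomials
             (λ i k → M (suc i) (punchIn j k)) (λ i k → e (suc i) (punchIn j k))
             (λ i k → w (suc i) (punchIn j k)) (λ i k → M≈ (suc i) (punchIn j k)) m)) m) ⟩
      s * shift (e zero j) (λ m → w zero j * Σ (λ c → minorTerm c m) (codes n)) m
        ≈⟨ *-congˡ (shift-cong (e zero j) (λ m → *-distribˡ-Σ (w zero j) (λ c → minorTerm c m) (codes n)) m) ⟩
      s * shift (e zero j) (λ m → Σ (λ c → w zero j * minorTerm c m) (codes n)) m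
        ≈⟨ *-congˡ (shift-Σ (e zero j) (λ c m → w zero j * minorTerm c m) (codes n) m) ⟩
      s * Σ (λ c → shift (e zero j) (λ m → w zero j * minorTerm c m) m) (codes n)
        ≈⟨ *-distribˡ-Σ s _ (codes n) ⟩
      Σ (λ c → s * shift (e zero j) (λ m → w zero j * minorTerm c m) m) (codes n)
        ≈⟨ Sum.⨁-cong (summand-∷ j) (codes n) ⟩
      Σ (λ c → summand (j ∷ c)) (codes n) ∎
      where
      s : Carrier
      s = (- 1#) ^ toℕ j
      minorTerm : Code n → ℕ → Carrier
      minorTerm c = monomial (E j c) (sgn c * W j c)

  -- Coefficients of the claimed expansion

  sumPick : ∀ {n} (k : Fin n) (f : Fin n → Carrier) → (∀ j → j ≢ k → f j ≈ 0#) →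
            Σ f (allFin n) ≈ f k
  sumPick zero f f≈0 = begin
    Σ f (allFin _)                        ≡⟨ Sum.⨁-allFin-suc f ⟩
    f zero + Σ (f ∘ suc) (allFin _)       ≈⟨ +-congˡ (Sum.⨁-identity (allFin _) λ {j} _ → f≈0 (suc j) λ ()) ⟩
    f zero + 0#                           ≈⟨ +-identityʳ _ ⟩
    f zero                                ∎
  sumPick (suc k) f f≈0 = begin
    Σ f (allFin _)                        ≡⟨ Sum.⨁-allFin-suc f ⟩
    f zero + Σ (f ∘ suc) (allFin _)       ≈⟨ +-cong (f≈0 zero λ ()) (sumPick k (f ∘ suc) λ j j≢k → f≈0 (suc j) (j≢k ∘ Fin.suc-injective)) ⟩
    0# + f (suc k)                        ≈⟨ +-identityˡ _ ⟩
    f (suc k)                             ∎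

  module _ {n : ℕ} (b : ℕ → Carrier) where

    private
      P : Poly
      P = sumₚ {suc n} λ k → C (b (toℕ k)) *ₚ X ^ₚ (n ∸ toℕ k)

      term : Fin (suc n) → ℕ → Carrier
      term k m = monomial (n ∸ toℕ k) (b (toℕ k) * 1#) m

      coeff-P : ∀ m → coeff P m ≈ Σ (λ k → term k m) (allFin (suc n))
      coeff-P m = ≈-trans (coeff-sum {suc n} (λ k → C (b (toℕ k)) *ₚ X ^ₚ (n ∸ toℕ k)) m)
        (Sum.⨁-cong (λ k → *ₚ-monomial {0} {n ∸ toℕ k} {p = C (b (toℕ k))} {X ^ₚ (n ∸ toℕ k)}
                             (C-monomial (b (toℕ k))) (X^-monomial (n ∸ toℕ k)) m)
                    (allFin (suc n)))

    coeff-sum-CX^-≤ : ∀ {m} → m ℕ.≤ n → coeff P m ≈ b (n ∸ m)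
    coeff-sum-CX^-≤ {m} m≤n = begin
      coeff P m                             ≈⟨ coeff-P m ⟩
      Σ (λ k → term k m) (allFin (suc n))   ≈⟨ sumPick k (λ k → term k m) other ⟩
      term k m                              ≡⟨ ≡.cong (λ i → monomial (n ∸ i) (b i * 1#) m) toℕ-k ⟩
      monomial (n ∸ (n ∸ m)) (b (n ∸ m) * 1#) m
                                            ≡⟨ ≡.cong (λ e → monomial e (b (n ∸ m) * 1#) m) (ℕ.m∸[m∸n]≡n m≤n) ⟩
      monomial m (b (n ∸ m) * 1#) m         ≡⟨ monomial-≡ m _ ⟩
      b (n ∸ m) * 1#                        ≈⟨ *-identityʳ _ ⟩
      b (n ∸ m)                             ∎
      where
      k : Fin (suc n)
      k = Fin.fromℕ< (s≤s (ℕ.m∸n≤m n m))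
      toℕ-k : toℕ k ≡ n ∸ m
      toℕ-k = Fin.toℕ-fromℕ< (s≤s (ℕ.m∸n≤m n m))
      other : ∀ j → j ≢ k → term j m ≈ 0#
      -- Indices are at most `n`, so truncated subtraction from `n` is injective on them.
      other j j≢k = reflexive (monomial-≢ {n ∸ toℕ j} {m} _ λ n∸j≡m →
        j≢k (Fin.toℕ-injective (≡.trans (≡.sym (ℕ.m∸[m∸n]≡n (ℕ.s≤s⁻¹ (Fin.toℕ<n j))))
                               (≡.trans (≡.cong (n ∸_) n∸j≡m) (≡.sym toℕ-k)))))

    coeff-sum-CX^-> : ∀ {m} → n ℕ.< m → coeff P m ≈ 0#
    coeff-sum-CX^-> {m} n<m = ≈-trans (coeff-P m) (Sum.⨁-identity (allFin (suc n)) λ {k} _ →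
      reflexive (monomial-≢ {n ∸ toℕ k} {m} _ (ℕ.<⇒≢ (ℕ.≤-<-trans (ℕ.m∸n≤m n (toℕ k)) n<m))))

  -- The characteristic polynomial as a sum over permutations

  module _ {n} (A : Matrix Carrier n) (A-diag : ∀ i → A i i ≈ 0#) where

    -- Since `A` vanishes on the diagonal, each entry of X I - A is a single monomial: X itself on
    -- the diagonal and a constant elsewhere.
    degree : Matrix ℕ n
    degree i j = if does (i Fin.≟ j) then 1 else 0

    weight : Matrix Carrier n
    weight i j = if does (i Fin.≟ j) then 1# else - A i j

    charPoly-entry : ∀ i j → IsMonomial (degree i j) (weight i j)
                                        ((X *ₚ identity i j) +ₚ map -_ (C (A i j)))
    charPoly-entry i j m with i Fin.≟ j
    ... | yes refl = begin
      coeff ((X *ₚ C 1#) +ₚ map -_ (C (A i i))) m            ≈⟨ coeff-+ (X *ₚ C 1#) (map -_ (C (A i i))) m ⟩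
      coeff (X *ₚ C 1#) m + coeff (map -_ (C (A i i))) m     ≈⟨ +-cong (*ₚ-monomial {1} {0} {p = X} {C 1#} X-monomial (C-monomial 1#) m) (-A-zero m) ⟩
      monomial 1 (1# * 1#) m + 0#                            ≈⟨ +-identityʳ _ ⟩
      monomial 1 (1# * 1#) m                                 ≈⟨ monomial-cong 1 (*-identityˡ 1#) m ⟩
      monomial 1 1# m                                        ∎
      where
      -A-zero : ∀ m → coeff (map -_ (C (A i i))) m ≈ 0#
      -A-zero zero    = ≈-trans (-‿cong (A-diag i)) -0#≈0#
      -A-zero (suc m) = ≈-refl
    ... | no _ = begin
      coeff ((X *ₚ []) +ₚ map -_ (C (A i j))) m              ≈⟨ coeff-+ (X *ₚ []) (map -_ (C (A i j))) m ⟩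
      coeff (X *ₚ []) m + coeff (map -_ (C (A i j))) m       ≈⟨ +-cong (X*0 m) (C-monomial (- A i j) m) ⟩
      0# + monomial 0 (- A i j) m                            ≈⟨ +-identityˡ _ ⟩
      monomial 0 (- A i j) m                                 ∎
      where
      -- `X *ₚ []` computes to a list of two zeros, not to `[]`.
      X*0 : ∀ m → coeff (X *ₚ []) m ≈ 0#
      X*0 zero          = ≈-refl
      X*0 (suc zero)    = ≈-refl
      X*0 (suc (suc m)) = ≈-refl

    coeff-charPoly : ∀ m → coeff (charPoly A) m ≈
      Σ (λ c → monomial (Σℕ.Σ (λ i → degree i (decode c i)) (allFin n))
                        (sgn c * Π (λ i → weight i (decode c i)) (allFin n)) m)
        (codes n)
    coeff-charPoly = det-monomials _ degree weight charPoly-entry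

  -- Signs of permutations

  -- The permutation of `c` precomposed with the transposition of `v` and `w`. Composition is not
  -- visible on Lehmer codes, so the new code, its values and its sign are constructed together.
  record Swapped {n} (c : Code n) (v w : Fin n) : Set ℓ where
    field
      code     : Code n
      at-v     : decode code v ≡ decode c w
      at-w     : decode code w ≡ decode c v
      elsewhere : ∀ i → i ≢ v → i ≢ w → decode code i ≡ decode c i
      sgn-code : sgn code ≈ - sgn c
  open Swapped

  private
    -1*-1*x≈x : ∀ x → - 1# * (- 1# * x) ≈ x
    -1*-1*x≈x x = ≈-trans (-1*x≈-x _) (≈-trans (-‿cong (-1*x≈-x x)) (-‿involutive x))

  -- The first two values are `a` and `punchIn a b`. Exchanged, they get the digits b and a - 1 if b
  -- < a, and b + 1 and a otherwise; either way the sum of the digits changes by one. Later values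
  -- stay, because removing two values in either order gives the same renumbering.
  swap₀₁-head : ∀ {n} (a : Fin (2 ℕ.+ n)) (b : Fin (suc n)) → ∃ λ b′ →
    punchIn (punchIn a b) b′ ≡ a ×
    (∀ k → punchIn (punchIn a b) (punchIn b′ k) ≡ punchIn a (punchIn b k)) ×
    (- 1#) ^ toℕ (punchIn a b) * (- 1#) ^ toℕ b′ ≈ - ((- 1#) ^ toℕ a * (- 1#) ^ toℕ b)
  swap₀₁-head zero b = zero , refl , (λ k → refl) , (begin
    (- 1# * (- 1#) ^ toℕ b) * 1#       ≈⟨ *-identityʳ _ ⟩
    - 1# * (- 1#) ^ toℕ b              ≈⟨ -1*x≈-x _ ⟩
    - ((- 1#) ^ toℕ b)                 ≈⟨ -‿cong (*-identityˡ _) ⟨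
    - (1# * (- 1#) ^ toℕ b)            ∎)
  swap₀₁-head (suc a) zero = a , refl , (λ k → refl) , (begin
    1# * (- 1#) ^ toℕ a                ≈⟨ *-identityˡ _ ⟩
    (- 1#) ^ toℕ a                     ≈⟨ -‿involutive _ ⟨
    - - ((- 1#) ^ toℕ a)               ≈⟨ -‿cong (-1*x≈-x _) ⟨
    - (- 1# * (- 1#) ^ toℕ a)          ≈⟨ -‿cong (*-identityʳ _) ⟨
    - ((- 1# * (- 1#) ^ toℕ a) * 1#)   ∎)
  swap₀₁-head {suc n} (suc a) (suc b) with swap₀₁-head a b
  ... | b′ , p , q , r = suc b′ , ≡.cong suc p , q′ , (begin
    (- 1# * (- 1#) ^ toℕ (punchIn a b)) * (- 1# * (- 1#) ^ toℕ b′)     ≈⟨ interchange _ _ _ _ ⟩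
    (- 1# * - 1#) * ((- 1#) ^ toℕ (punchIn a b) * (- 1#) ^ toℕ b′)     ≈⟨ *-congˡ r ⟩
    (- 1# * - 1#) * - ((- 1#) ^ toℕ a * (- 1#) ^ toℕ b)                ≈⟨ -‿distribʳ-* _ _ ⟨
    - ((- 1# * - 1#) * ((- 1#) ^ toℕ a * (- 1#) ^ toℕ b))              ≈⟨ -‿cong (interchange _ _ _ _) ⟩
    - ((- 1# * (- 1#) ^ toℕ a) * (- 1# * (- 1#) ^ toℕ b))              ∎)
    where
    q′ : ∀ k → punchIn (suc (punchIn a b)) (punchIn (suc b′) k) ≡ punchIn (suc a) (punchIn (suc b) k)
    q′ zero    = refl
    q′ (suc k) = ≡.cong suc (q k)

  swap₀₁ : ∀ {n} (c : Code (2 ℕ.+ n)) → Swapped c zero (suc zero)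
  swap₀₁ (a ∷ b ∷ c) with swap₀₁-head a b
  ... | b′ , p , q , r = record
    { code      = punchIn a b ∷ b′ ∷ c
    ; at-v      = refl
    ; at-w      = p
    ; elsewhere = λ
      { zero          i≢v i≢w → contradiction refl i≢v
      ; (suc zero)    i≢v i≢w → contradiction refl i≢w
      ; (suc (suc i)) i≢v i≢w → q (decode c i)
      }
    ; sgn-code  = begin
        (- 1#) ^ toℕ (punchIn a b) * ((- 1#) ^ toℕ b′ * sgn c)   ≈⟨ *-assoc _ _ _ ⟨
        (- 1#) ^ toℕ (punchIn a b) * (- 1#) ^ toℕ b′ * sgn c     ≈⟨ *-congʳ r ⟩
        - ((- 1#) ^ toℕ a * (- 1#) ^ toℕ b) * sgn c              ≈⟨ -‿distribˡ-* _ _ ⟨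
        - ((- 1#) ^ toℕ a * (- 1#) ^ toℕ b * sgn c)              ≈⟨ -‿cong (*-assoc _ _ _) ⟩
        - ((- 1#) ^ toℕ a * ((- 1#) ^ toℕ b * sgn c))            ∎
    }

  swap-sym : ∀ {n} {c : Code n} {v w} → Swapped c v w → Swapped c w v
  swap-sym s = record
    { code = code s ; at-v = at-w s ; at-w = at-v s
    ; elsewhere = λ i i≢w i≢v → elsewhere s i i≢v i≢w ; sgn-code = sgn-code s }

  swap-suc : ∀ {n} j {c : Code n} {v w} → Swapped c v w → Swapped (j ∷ c) (suc v) (suc w)
  swap-suc j {c} s = record
    { code      = j ∷ code s
    ; at-v      = ≡.cong (punchIn j) (at-v s)
    ; at-w      = ≡.cong (punchIn j) (at-w s)
    ; elsewhere = λ
      { zero    _   _   → refl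
      ; (suc i) i≢v i≢w → ≡.cong (punchIn j) (elsewhere s i (i≢v ∘ ≡.cong suc) (i≢w ∘ ≡.cong suc))
      }
    ; sgn-code  = ≈-trans (*-congˡ (sgn-code s)) (≈-sym (-‿distribʳ-* _ _))
    }

  -- The transposition (0 w) is the conjugate of (1 w) by (0 1) when w > 1.
  swap-conjugate : ∀ {n} {c : Code (2 ℕ.+ n)} {w} (s : Swapped c zero (suc zero))
    (t : Swapped (code s) (suc zero) (suc (suc w))) →
    Swapped (code t) zero (suc zero) → Swapped c zero (suc (suc w))
  swap-conjugate {c = c} {w} s t u = record
    { code      = code u
    ; at-v      = ≡.trans (at-v u) (≡.trans (at-v t) (elsewhere s _ (λ ()) (λ ())))
    ; at-w      = ≡.trans (elsewhere u _ (λ ()) (λ ())) (≡.trans (at-w t) (at-w s))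
    ; elsewhere = λ
      { zero          i≢v i≢w → contradiction refl i≢v
      ; (suc zero)    i≢v i≢w → ≡.trans (at-w u) (≡.trans (elsewhere t _ (λ ()) (λ ())) (at-v s))
      ; (suc (suc i)) i≢v i≢w → ≡.trans (elsewhere u _ (λ ()) (λ ()))
          (≡.trans (elsewhere t _ (λ ()) i≢w) (elsewhere s _ (λ ()) (λ ())))
      }
    ; sgn-code  = begin
        sgn (code u)       ≈⟨ sgn-code u ⟩
        - sgn (code t)     ≈⟨ -‿cong (sgn-code t) ⟩
        - - sgn (code s)   ≈⟨ -‿involutive _ ⟩
        sgn (code s)       ≈⟨ sgn-code s ⟩
        - sgn c            ∎
    }

  swap : ∀ {n} (c : Code n) v w → v ≢ w → Swapped c v w
  swap₀ : ∀ {n} (c : Code (suc n)) w → Swapped c zero (suc w)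

  swap c       zero    zero    v≢w = contradiction refl v≢w
  swap c       zero    (suc w) v≢w = swap₀ c w
  swap c       (suc v) zero    v≢w = swap-sym (swap₀ c v)
  swap (j ∷ c) (suc v) (suc w) v≢w = swap-suc j (swap c v w (v≢w ∘ ≡.cong suc))

  swap₀ {suc n} c zero    = swap₀₁ c
  swap₀ {suc n} c (suc w) with swap₀₁ c
  ... | s with code s in eq
  ... | j ∷ c′ = swap-conjugate s t (swap₀₁ (code t))
    where
    -- This transposition does not touch position 0, so it acts on the remaining digits `c′`, where
    -- it again has the form (0 w).
    t : Swapped (code s) (suc zero) (suc (suc w))
    t = ≡.subst (λ c → Swapped c (suc zero) (suc (suc w))) (≡.sym eq) (swap-suc j (swap₀ c′ w))

  sgn-identity : ∀ {n} (c : Code n) → (∀ i → decode c i ≡ i) → sgn c ≈ 1#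
  sgn-identity []      c≗id = ≈-refl
  sgn-identity (zero  ∷ c) c≗id =
    ≈-trans (*-identityˡ _) (sgn-identity c (Fin.suc-injective ∘ c≗id ∘ suc))
  sgn-identity (suc j ∷ c) c≗id with () ← c≗id zero

  -- The sign (-1)^(l-1) of a cycle of length l, with exponent l + 1 to avoid subtraction.
  cycleSign : ∀ {b} {B : Set b} → List B → Carrier
  cycleSign vs = - 1# * (- 1#) ^ List.length vs

  -- Serves two purposes: with `x` and `x′` different it bypasses the vertex taken out of a cycle,
  -- and with `x` and `x′` equal it carries over the cycles that the exchange leaves alone.
  reroute : ∀ {n} {f g : Fin n → Fin n} {x x′ y} xs → f x ≡ g x′ → All (λ i → f i ≡ g i) xs →
            Linked (Step f) (x ∷ xs ∷ʳ y) → Linked (Step g) (x′ ∷ xs ∷ʳ y)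
  reroute []       fx≡gx′ []            (x⟶y ∷ [-]) = ≡.trans (≡.sym fx≡gx′) x⟶y ∷ [-]
  reroute (z ∷ xs) fx≡gx′ (fz≡gz ∷ f≡g) (x⟶z ∷ ps)  =
    ≡.trans (≡.sym fx≡gx′) x⟶z ∷ reroute xs fz≡gz f≡g ps

  -- Exchanging the values at v and w takes w out of the cycle v ⟶ w ⟶ ⋯ ⟶ v.
  sgn-cycles : ∀ {n} (c : Code n) L → All (ClosedWalk (decode c)) L → Unique (concat L) →
               (∀ i → i ∉ concat L → decode c i ≡ i) → sgn c ≈ Π cycleSign L
  sgn-cycle∷cycles : ∀ {n} (c : Code n) v vs L → ClosedWalk (decode c) (v ∷ vs) →
    All (ClosedWalk (decode c)) L → Unique (v ∷ vs ++ concat L) →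
    (∀ i → i ∉ v ∷ vs ++ concat L → decode c i ≡ i) →
    sgn c ≈ cycleSign (v ∷ vs) * Π cycleSign L

  sgn-cycles c []             []       u fix = sgn-identity c λ i → fix i λ ()
  sgn-cycles c ((v ∷ vs) ∷ L) (p ∷ ps) u fix = sgn-cycle∷cycles c v vs L p ps u fix

  sgn-cycle∷cycles c v [] L (v⟶v ∷ [-]) ps (_ ∷ u) fix = begin
    sgn c                                   ≈⟨ sgn-cycles c L ps u fix′ ⟩
    Π cycleSign L                           ≈⟨ *-identityˡ _ ⟨
    1# * Π cycleSign L                      ≈⟨ *-congʳ (-1*-1*x≈x 1#) ⟨
    cycleSign (v ∷ []) * Π cycleSign L      ∎
    where
    fix′ : ∀ i → i ∉ concat L → decode c i ≡ i
    fix′ i i∉L with i Fin.≟ v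
    ... | yes refl = v⟶v
    ... | no  i≢v  = fix i λ { (here i≡v) → i≢v i≡v ; (there i∈L) → i∉L i∈L }
  sgn-cycle∷cycles {n} c v (w ∷ ws) L (v⟶w ∷ p) ps ((v≢w ∷ v∉) ∷ w∉ ∷ u) fix = begin
    sgn c                                           ≈⟨ -‿involutive _ ⟨
    - - sgn c                                       ≈⟨ -‿cong (sgn-code s) ⟨
    - sgn (code s)                                  ≈⟨ -‿cong (sgn-cycle∷cycles (code s) v ws L
                                                         (reroute ws (≡.sym (at-v s)) (All.++⁻ˡ ws same) p)
                                                         (All.tabulate unchanged) (v∉ ∷ u) fix′) ⟩
    - (cycleSign (v ∷ ws) * Π cycleSign L)          ≈⟨ -‿distribˡ-* _ _ ⟩
    - cycleSign (v ∷ ws) * Π cycleSign L            ≈⟨ *-congʳ (≈-sym (-1*x≈-x _)) ⟩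
    (- 1# * cycleSign (v ∷ ws)) * Π cycleSign L     ∎
    where
    s : Swapped c v w
    s = swap c v w v≢w

    same : All (λ i → decode c i ≡ decode (code s) i) (ws ++ concat L)
    same = All.zipWith (λ (v≢i , w≢i) → ≡.sym (elsewhere s _ (v≢i ∘ ≡.sym) (w≢i ∘ ≡.sym))) (v∉ , w∉)

    unchanged : ∀ {vs} → vs ∈ L → ClosedWalk (decode (code s)) vs
    unchanged {vs} vs∈L with All.lookup ps vs∈L | All.lookup (All.concat⁻ (All.++⁻ʳ ws same)) vs∈L
    unchanged {x ∷ xs} _ | q | fx≡gx ∷ f≡g = reroute xs fx≡gx f≡g q

    fix′ : ∀ i → i ∉ v ∷ ws ++ concat L → decode (code s) i ≡ i
    fix′ i i∉ with i Fin.≟ w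
    ... | yes refl = ≡.trans (at-w s) v⟶w
    ... | no  i≢w  = ≡.trans (elsewhere s i (i∉ ∘ here) i≢w)
      (fix i λ { (here i≡v) → i∉ (here i≡v) ; (there (here i≡w)) → i≢w i≡w ; (there (there i∈)) → i∉ (there i∈) })

-- Enumerations without repetition

unique∧set⇒↭ : ∀ {a} {A : Set a} {xs ys : List A} → Unique xs → Unique ys →
               (∀ {x} → x ∈ xs → x ∈ ys) → (∀ {x} → x ∈ ys → x ∈ xs) → xs ↭ ys
unique∧set⇒↭ xs! ys! xs⊆ys ys⊆xs = ∼bag⇒↭ (unique∧set⇒bag xs! ys! (mk⇔ xs⊆ys ys⊆xs))

-- The positions of the list inject into `Fin n`. Hence no directed cycle is too long for the
-- enumeration of candidates.
unique⇒length≤ : ∀ {n} {xs : List (Fin n)} → Unique xs → List.length xs ℕ.≤ n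
unique⇒length≤ xs! = Fin.injective⇒≤ (lookup-injective xs!)
  where
  lookup-injective : ∀ {a} {A : Set a} {xs : List A} → Unique xs →
                     ∀ {i j} → List.lookup xs i ≡ List.lookup xs j → i ≡ j
  lookup-injective (x∉ ∷ _)  {zero}  {zero}  _  = refl
  lookup-injective (x∉ ∷ _)  {zero}  {suc j} eq = contradiction eq (All.lookup x∉ (∈-lookup j))
  lookup-injective (x∉ ∷ _)  {suc i} {zero}  eq = contradiction (≡.sym eq) (All.lookup x∉ (∈-lookup i))
  lookup-injective (_ ∷ xs!) {suc i} {suc j} eq = ≡.cong suc (lookup-injective xs! eq)

module _ {a} {A : Set a} {xs : List A} where

  ∈-vectors : (∀ x → x ∈ xs) → ∀ {n} (v : Vec A n) → v ∈ vectors xs n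
  ∈-vectors ∈xs []      = here refl
  ∈-vectors ∈xs (x ∷ v) = ∈-cartesianProductWith⁺ _∷_ (∈xs x) (∈-vectors ∈xs v)

  vectors-unique : Unique xs → ∀ n → Unique (vectors xs n)
  vectors-unique xs! zero    = [] ∷ []
  vectors-unique xs! (suc n) =
    Unique.cartesianProductWith⁺ _∷_ Vec.∷-injective xs! (vectors-unique xs! n)

module _ {n} (𝒜 : ArcSet n) where

  private
    lists : ℕ → List (List (Fin n))
    lists l = map Vec.toList (vectors (allFin n) l)

    length-lists : ∀ {l xs} → xs ∈ lists l → List.length xs ≡ l
    length-lists xs∈ with v , _ , refl ← ∈-map⁻ Vec.toList xs∈ = Vec.length-toList v

    candidates : List (List (Fin n))
    candidates = List.concatMap lists (List.upTo (suc n))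

  ∈-directedCycles⁻ : ∀ {vs} → vs ∈ directedCycles 𝒜 → IsDirectedCycle 𝒜 vs
  ∈-directedCycles⁻ vs∈ = proj₂ (∈-filter⁻ (isDirectedCycle? 𝒜) {xs = candidates} vs∈)

  ∈-directedCycles⁺ : ∀ {vs} → IsDirectedCycle 𝒜 vs → vs ∈ directedCycles 𝒜
  ∈-directedCycles⁺ {v ∷ vs} cyc@(_ , vs! , _) = ∈-filter⁺ (isDirectedCycle? 𝒜) {xs = candidates}
    (∈-concat⁺′ {xss = map lists (List.upTo (suc n))} vs∈lists (∈-map⁺ lists (∈-upTo⁺ (s≤s (unique⇒length≤ vs!)))))
    cyc
    where
    vs∈lists : v ∷ vs ∈ lists (List.length (v ∷ vs))
    vs∈lists = ≡.subst (_∈ lists (List.length (v ∷ vs))) (Vec.toList∘fromList (v ∷ vs))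
      (∈-map⁺ Vec.toList (∈-vectors ∈-allFin (Vec.fromList (v ∷ vs))))

  -- Candidates are grouped by length, so different groups are disjoint; within a group `toList` is
  -- injective.
  directedCycles-unique : Unique (directedCycles 𝒜)
  directedCycles-unique = Unique.filter⁺ (isDirectedCycle? 𝒜) {xs = candidates} (Unique.concat⁺ {xss = map lists (List.upTo (suc n))}
    (All.map⁺ {f = lists} (All.tabulate {xs = List.upTo (suc n)} λ {l} _ → Unique.map⁺ toList-injective (vectors-unique (Unique.allFin⁺ n) l)))
    (AllPairs.map⁺ {f = lists} (AllPairs.map
      (λ k≢l {_} (xs∈k , xs∈l) → k≢l (≡.trans (≡.sym (length-lists xs∈k)) (length-lists xs∈l)))
      (Unique.upTo⁺ (suc n)))))
    where
    toList-injective : ∀ {l} {v w : Vec (Fin n) l} → Vec.toList v ≡ Vec.toList w → v ≡ w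
    toList-injective {v = v} {w} eq =
      ≡.trans (≡.sym (Vec.cast-is-id refl v)) (Vec.toList-injective refl v w eq)

-- Directed cycles of a permutation

module FunctionalGraph {n} (𝒜 : ArcSet n) (f : Fin n → Fin n)
  (f-injective : ∀ {i j} → f i ≡ f j → i ≡ j)
  (arc⁻ : ∀ {i j} → Arc 𝒜 i j → f i ≡ j × f i ≢ i)
  (arc⁺ : ∀ {i} → f i ≢ i → Arc 𝒜 i (f i)) where

  Path : List (Fin n) → Set
  Path = Linked (Arc 𝒜)

  -- A vertex has at most one outgoing arc, so the paths could differ only by one of them passing
  -- through `v` and going on; the last two hypotheses rule this out.
  path-functional : ∀ {x v} vs ws → Path (x ∷ vs ∷ʳ v) → Path (x ∷ ws ∷ʳ v) →
                    v ∉ vs → v ∉ ws → vs ≡ ws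
  path-functional []       []       p       q       _    _    = refl
  path-functional []       (w ∷ ws) (r ∷ _) (s ∷ _) _    v∉ws =
    contradiction (here (≡.trans (≡.sym (proj₁ (arc⁻ r))) (proj₁ (arc⁻ s)))) v∉ws
  path-functional (u ∷ vs) []       (r ∷ _) (s ∷ _) v∉vs _    =
    contradiction (here (≡.trans (≡.sym (proj₁ (arc⁻ s))) (proj₁ (arc⁻ r)))) v∉vs
  path-functional (u ∷ vs) (w ∷ ws) (r ∷ p) (s ∷ q) v∉vs v∉ws
    with refl ← ≡.trans (≡.sym (proj₁ (arc⁻ r))) (proj₁ (arc⁻ s))
    = ≡.cong (u ∷_) (path-functional vs ws p q (v∉vs ∘ there) (v∉ws ∘ there))

  path-successor : ∀ {x v i} vs → Path (x ∷ vs ∷ʳ v) → i ∈ x ∷ vs → f i ∈ vs ∷ʳ v × f i ≢ i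
  path-successor []       (r ∷ _) (here refl) = here (proj₁ (arc⁻ r)) , proj₂ (arc⁻ r)
  path-successor (w ∷ vs) (r ∷ p) (here refl) = here (proj₁ (arc⁻ r)) , proj₂ (arc⁻ r)
  path-successor (w ∷ vs) (r ∷ p) (there i∈)  =
    there (proj₁ (path-successor vs p i∈)) , proj₂ (path-successor vs p i∈)

  path-end : ∀ {p} {P : Fin n → Set p} → (∀ {i} → P i → P (f i)) →
             ∀ {x v i} vs → Path (x ∷ vs ∷ʳ v) → i ∈ x ∷ vs → P i → P v
  path-end {P = P} step []       (r ∷ _) (here refl) Pi = ≡.subst P (proj₁ (arc⁻ r)) (step Pi)
  path-end {P = P} step (w ∷ vs) (r ∷ p) (here refl) Pi =
    path-end {P = P} step vs p (here refl) (≡.subst P (proj₁ (arc⁻ r)) (step Pi))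
  path-end {P = P} step (w ∷ vs) (r ∷ p) (there i∈)  Pi = path-end {P = P} step vs p i∈ Pi

  cycle-closed : ∀ {v i} vs → Path (v ∷ vs ∷ʳ v) → i ∈ v ∷ vs → f i ∈ v ∷ vs
  cycle-closed vs p i∈ with ∈-++⁻ vs (proj₁ (path-successor vs p i∈))
  ... | inj₁ fi∈vs       = there fi∈vs
  ... | inj₂ (here fi≡v) = here fi≡v

  -- Following the second cycle from the shared vertex `u` leads to its head `w` without leaving the
  -- first cycle, whose least vertex is `v`.
  cycle-head-≤ : ∀ {v w u} vs ws → All (v Fin.<_) vs → Path (v ∷ vs ∷ʳ v) → Path (w ∷ ws ∷ʳ w) →
                 u ∈ v ∷ vs → u ∈ w ∷ ws → v Fin.≤ w
  cycle-head-≤ {v} {w} vs ws v<vs p q u∈vs u∈ws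
    with path-end {P = _∈ v ∷ vs} (cycle-closed vs p) ws q u∈ws u∈vs
  ... | here refl = ℕ.≤-refl
  ... | there w∈  = ℕ.<⇒≤ (All.lookup v<vs w∈)

  -- By minimality in both directions the heads agree, and from a common head `path-functional`
  -- determines the rest.
  cycles-meet⇒≡ : ∀ {vs ws u} → IsDirectedCycle 𝒜 vs → IsDirectedCycle 𝒜 ws →
                  u ∈ vs → u ∈ ws → vs ≡ ws
  cycles-meet⇒≡ {v ∷ vs} {w ∷ ws} (v< , v∉ ∷ _ , p) (w< , w∉ ∷ _ , q) u∈vs u∈ws
    with refl ← Fin.≤-antisym (cycle-head-≤ vs ws v< p q u∈vs u∈ws) (cycle-head-≤ ws vs w< q p u∈ws u∈vs)
    = ≡.cong (v ∷_) (path-functional vs ws p q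
        (λ v∈ → All.lookup v∉ v∈ refl) (λ v∈ → All.lookup w∉ v∈ refl))

  -- Were a vertex to occur twice, the path from its second occurrence would also lead to `v`, and
  -- `path-functional` would equate a list with a proper suffix of itself.
  path-unique : ∀ {x v} vs → Path (x ∷ vs ∷ʳ v) → v ∉ vs → Unique vs
  path-unique []           _       _   = []
  path-unique {v = v} (y ∷ vs) (_ ∷ p) v∉ =
    All.¬Any⇒All¬ vs y∉vs ∷ path-unique vs p (v∉ ∘ there)
    where
    drop : ∀ us {ws} → Path (us ++ ws) → Path ws
    drop []       p = p
    drop (u ∷ us) p = drop us (Linked.tail p)

    y∉vs : y ∉ vs
    y∉vs y∈vs with us , ws , refl ← ∈-∃++ y∈vs =
      contradiction
        (≡.trans (≡.sym (≡.cong List.length vs≡ws)) (length-++ us))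
        (ℕ.<⇒≢ (ℕ.m≤n+m (suc (List.length ws)) (List.length us)))
      where
      vs≡ws : us ++ y ∷ ws ≡ ws
      vs≡ws = path-functional _ ws p
        (drop (y ∷ us) (≡.subst (λ zs → Path (y ∷ zs)) (++-assoc us (y ∷ ws) _) p))
        (v∉ ∘ there) (λ v∈ → v∉ (there (∈-++⁺ʳ us (there v∈))))

  f^ : ℕ → Fin n → Fin n
  f^ zero    x = x
  f^ (suc k) x = f^ k (f x)

  f^-suc : ∀ k x → f^ (suc k) x ≡ f (f^ k x)
  f^-suc zero    x = refl
  f^-suc (suc k) x = f^-suc k (f x)

  f^-cancel : ∀ {i j} x → i ℕ.< j → f^ i x ≡ f^ j x → ∃ λ k → f^ (suc k) x ≡ x
  f^-cancel {zero}  {suc j} x _         eq = j , ≡.sym eq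
  f^-cancel {suc i} {suc j} x (s≤s i<j) eq =
    f^-cancel x i<j (f-injective (≡.trans (≡.sym (f^-suc i x)) (≡.trans eq (f^-suc j x))))

  -- Two of the n + 1 iterates from 0 to n agree, and injectivity cancels their common applications.
  period : ∀ x → ∃ λ k → f^ (suc k) x ≡ x
  period x with i , j , i<j , eq ← Fin.pigeonhole ℕ.≤-refl (λ i → f^ (toℕ {suc n} i) x)
    = f^-cancel x i<j eq

  -- `k` only bounds the search, as the period found by the pigeonhole principle need not be
  -- minimal; stopping at the first visit gives `v ∉ vs`. The target `v` is kept apart from the
  -- start `x`, which moves along the orbit.
  firstReturn : ∀ k x v → f x ≢ x → f^ (suc k) x ≡ v → ∃ λ vs → Path (x ∷ vs ∷ʳ v) × v ∉ vs
  firstReturn zero    x _ fx≢x refl = [] , arc⁺ fx≢x ∷ [-] , λ ()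
  firstReturn (suc k) x v fx≢x eq with f x Fin.≟ v
  ... | yes refl = [] , arc⁺ fx≢x ∷ [-] , λ ()
  ... | no  fx≢v with vs , p , v∉vs ← firstReturn k (f x) v (fx≢x ∘ f-injective) eq =
    f x ∷ vs , arc⁺ fx≢x ∷ p , λ { (here v≡fx) → fx≢v (≡.sym v≡fx) ; (there v∈) → v∉vs v∈ }

  Reaches : Fin n → Fin n → Set
  Reaches v u = ∃ λ k → f^ k v ≡ u

  reaches-step : ∀ {w v} → Reaches w v → Reaches w (f v)
  reaches-step (k , refl) = suc k , f^-suc k _

  reaches-closed : ∀ {p} {P : Fin n → Set p} → (∀ {i} → P i → P (f i)) →
                   ∀ {v u} → P v → Reaches v u → P u
  reaches-closed {P = P} step Pv (zero  , refl) = Pv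
  reaches-closed {P = P} step Pv (suc k , eq)   = reaches-closed {P = P} step (step Pv) (k , eq)

  -- Restarting from any smaller vertex on the cycle leads to the least one.
  cycleThrough : ∀ {u} → f u ≢ u → ∃ λ vs → IsDirectedCycle 𝒜 vs × u ∈ vs
  cycleThrough {u} fu≢u = from u (Fin.<-wellFounded u) fu≢u (0 , refl)
    where
    from : ∀ v → Acc Fin._<_ v → f v ≢ v → Reaches v u → ∃ λ vs → IsDirectedCycle 𝒜 vs × u ∈ vs
    from v (acc rec) fv≢v v⇝u
      with k , eq ← period v
      with vs , p , v∉vs ← firstReturn k v v fv≢v eq
      with All.all? (v Fin.<?_) vs
    ... | yes v<vs = v ∷ vs
      , (v<vs , All.¬Any⇒All¬ vs v∉vs ∷ path-unique vs p v∉vs , p)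
      , reaches-closed {P = _∈ v ∷ vs} (cycle-closed vs p) (here refl) v⇝u
    ... | no v≮vs with w , w∈vs , v≮w ← find (All.¬All⇒Any¬ (v Fin.<?_) vs v≮vs) =
      from w (rec (Fin.≤∧≢⇒< (ℕ.≮⇒≥ v≮w) λ { refl → v∉vs w∈vs }))
        (proj₂ (path-successor vs p (there w∈vs)))
        -- `w` reaches `v` by completing the cycle, and `v` reaches `u`.
        (reaches-closed {P = Reaches w} reaches-step
          (path-end {P = Reaches w} reaches-step vs p (there w∈vs) (0 , refl)) v⇝u)

  ∈-directedCycles⇒moved : ∀ {vs u} → vs ∈ directedCycles 𝒜 → u ∈ vs → f u ≢ u
  ∈-directedCycles⇒moved {vs} vs∈ u∈vs with vs | ∈-directedCycles⁻ 𝒜 vs∈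
  ... | v ∷ vs | _ , _ , p = proj₂ (path-successor vs p u∈vs)

  concat-directedCycles-unique : Unique (concat (directedCycles 𝒜))
  concat-directedCycles-unique = Unique.concat⁺ (All.tabulate (unique ∘ ∈-directedCycles⁻ 𝒜))
    (disjoint (directedCycles-unique 𝒜) (All.tabulate (∈-directedCycles⁻ 𝒜)))
    where
    unique : ∀ {vs} → IsDirectedCycle 𝒜 vs → Unique vs
    unique {v ∷ vs} (_ , vs! , _) = vs!

    disjoint : ∀ {L} → Unique L → All (IsDirectedCycle 𝒜) L → AllPairs Disjoint L
    disjoint []            []           = []
    disjoint (vs∉L ∷ L!) (cyc ∷ cycs) =
      All.zipWith (λ (vs≢ws , cyc′) {_} (u∈vs , u∈ws) → vs≢ws (cycles-meet⇒≡ cyc cyc′ u∈vs u∈ws)) (vs∉L , cycs)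
      ∷ disjoint L! cycs

  -- Cycles that meet coincide, and every moved point lies on one. A product over the moved points
  -- can therefore be regrouped cycle by cycle.
  concat-directedCycles-↭ : concat (directedCycles 𝒜) ↭ filter (λ i → ¬? (f i Fin.≟ i)) (allFin n)
  concat-directedCycles-↭ = unique∧set⇒↭ concat-directedCycles-unique
    (Unique.filter⁺ _ (Unique.allFin⁺ n))
    (λ u∈ → let vs , u∈vs , vs∈ = ∈-concat⁻′ (directedCycles 𝒜) u∈ in
            ∈-filter⁺ _ (∈-allFin _) (∈-directedCycles⇒moved vs∈ u∈vs))
    (λ {u} u∈ → let vs , cyc , u∈vs = cycleThrough (proj₂ (∈-filter⁻ (λ i → ¬? (f i Fin.≟ i)) {xs = allFin n} u∈)) in
            ∈-concat⁺′ u∈vs (∈-directedCycles⁺ 𝒜 cyc))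

-- Codes and injective functions

decode-injective : ∀ {n} (c : Code n) {i j} → decode c i ≡ decode c j → i ≡ j
decode-injective (a ∷ c) {zero}  {zero}  eq = refl
decode-injective (a ∷ c) {zero}  {suc j} eq = contradiction (≡.sym eq) (Fin.punchInᵢ≢i a (decode c j))
decode-injective (a ∷ c) {suc i} {zero}  eq = contradiction eq (Fin.punchInᵢ≢i a (decode c i))
decode-injective (a ∷ c) {suc i} {suc j} eq =
  ≡.cong suc (decode-injective c (Fin.punchIn-injective a _ _ eq))

decode-determines : ∀ {n} {c d : Code n} → (∀ i → decode c i ≡ decode d i) → c ≡ d
decode-determines {c = []}    {[]}    c≗d = refl
decode-determines {c = a ∷ c} {b ∷ d} c≗d with refl ← c≗d zero =
  ≡.cong (a ∷_) (decode-determines λ i → Fin.punchIn-injective a _ _ (c≗d (suc i)))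

encode : ∀ {n} (f : Fin n → Fin n) → (∀ {i j} → f i ≡ f j → i ≡ j) →
         ∃ λ (c : Code n) → ∀ i → decode c i ≡ f i
encode {zero}  f inj = [] , λ ()
encode {suc n} f inj = f zero ∷ proj₁ rest , λ
  { zero    → refl
  ; (suc i) → ≡.trans (≡.cong (punchIn (f zero)) (proj₂ rest i)) (Fin.punchIn-punchOut (f₀≢ i))
  }
  where
  f₀≢ : ∀ i → f zero ≢ f (suc i)
  f₀≢ i eq with () ← inj eq
  rest : ∃ λ (c : Code n) → ∀ i → decode c i ≡ punchOut (f₀≢ i)
  rest = encode (λ i → punchOut (f₀≢ i))
    λ {i} {j} eq → Fin.suc-injective (inj (Fin.punchOut-injective (f₀≢ i) (f₀≢ j) eq))

∈-codes : ∀ {n} (c : Code n) → c ∈ codes n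
∈-codes []      = here refl
∈-codes (j ∷ c) = ∈-cartesianProductWith⁺ _∷_ (∈-allFin j) (∈-codes c)

codes-unique : ∀ n → Unique (codes n)
codes-unique zero    = [] ∷ []
codes-unique (suc n) = Unique.cartesianProductWith⁺ _∷_ (λ { refl → refl , refl })
  (Unique.allFin⁺ (suc n)) (codes-unique n)

-- Elementary subdigraphs as permutations

∣p∣≡0⇒empty : ∀ {n} (p : Subset n) → ∣ p ∣ ≡ 0 → p ≡ ∅
∣p∣≡0⇒empty []            eq = refl
∣p∣≡0⇒empty (outside ∷ p) eq = ≡.cong (outside ∷_) (∣p∣≡0⇒empty p eq)

∣p∣≡1⇒singleton : ∀ {n} (p : Subset n) → ∣ p ∣ ≡ 1 → ∃ λ x → p ≡ ⁅ x ⁆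
∣p∣≡1⇒singleton (inside  ∷ p) eq = zero , ≡.cong (inside ∷_) (∣p∣≡0⇒empty p (ℕ.suc-injective eq))
∣p∣≡1⇒singleton (outside ∷ p) eq with x , p≡ ← ∣p∣≡1⇒singleton p eq = suc x , ≡.cong (outside ∷_) p≡

∣tabulate-not∣ : ∀ {n} (b : Fin n → Bool) →
                 ∣ Vec.tabulate (not ∘ b) ∣ ℕ.+ Σℕ.Σ (λ i → if b i then 1 else 0) (allFin n) ≡ n
∣tabulate-not∣ {zero}  b = refl
∣tabulate-not∣ {suc n} b
  rewrite Σℕ.⨁-allFin-suc (λ i → if b i then 1 else 0) with b zero
... | true  = ≡.trans (ℕ.+-suc _ _) (≡.cong suc (∣tabulate-not∣ (b ∘ suc)))
... | false = ≡.cong suc (∣tabulate-not∣ (b ∘ suc))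

module _ {n} {𝒜 : ArcSet n} {i j : Fin n} where

  ∈-inN⁺ : Arc 𝒜 i j → i ∈ₛ inN 𝒜 j
  ∈-inN⁺ ij = Vec.lookup⇒[]= i (inN 𝒜 j)
    (≡.trans (Vec.lookup-map i _ 𝒜) (Vec.[]=⇒lookup ij))

  ∈-inN⁻ : i ∈ₛ inN 𝒜 j → Arc 𝒜 i j
  ∈-inN⁻ i∈ = Vec.lookup⇒[]= j (outN 𝒜 i)
    (≡.trans (≡.sym (Vec.lookup-map i _ 𝒜)) (Vec.[]=⇒lookup i∈))

module _ {n : ℕ} where

  functionGraph : (Fin n → Fin n) → Subgraph n
  functionGraph f = subgraph
    (Vec.tabulate λ i → not (does (i Fin.≟ f i)))
    (Vec.tabulate λ i → if does (i Fin.≟ f i) then ∅ else ⁅ f i ⁆)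

  module _ (f : Fin n → Fin n) where
    open Subgraph (functionGraph f)

    functionGraph-verts⁺ : ∀ {i} → f i ≢ i → i ∈ₛ verts
    functionGraph-verts⁺ {i} fi≢i = Vec.lookup⇒[]= i verts
      (≡.trans (Vec.lookup∘tabulate (λ i → not (does (i Fin.≟ f i))) i) lemma)
      where
      lemma : not (does (i Fin.≟ f i)) ≡ true
      lemma with i Fin.≟ f i
      ... | yes i≡fi = contradiction (≡.sym i≡fi) fi≢i
      ... | no  _    = refl

    functionGraph-verts⁻ : ∀ {i} → i ∈ₛ verts → f i ≢ i
    functionGraph-verts⁻ {i} i∈ fi≡i with i Fin.≟ f i
      | ≡.trans (≡.sym (Vec.lookup∘tabulate (λ i → not (does (i Fin.≟ f i))) i)) (Vec.[]=⇒lookup i∈)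
    ... | no i≢fi | _ = i≢fi (≡.sym fi≡i)

    functionGraph-outN : ∀ {i} → f i ≢ i → outN arcs i ≡ ⁅ f i ⁆
    functionGraph-outN {i} fi≢i = ≡.trans
      (Vec.lookup∘tabulate (λ i → if does (i Fin.≟ f i) then ∅ else ⁅ f i ⁆) i) lemma
      where
      lemma : (if does (i Fin.≟ f i) then ∅ else ⁅ f i ⁆) ≡ ⁅ f i ⁆
      lemma with i Fin.≟ f i
      ... | yes i≡fi = contradiction (≡.sym i≡fi) fi≢i
      ... | no  _    = refl

    functionGraph-outN-fixed : ∀ {i} → f i ≡ i → outN arcs i ≡ ∅
    functionGraph-outN-fixed {i} fi≡i = ≡.trans
      (Vec.lookup∘tabulate (λ i → if does (i Fin.≟ f i) then ∅ else ⁅ f i ⁆) i) lemma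
      where
      lemma : (if does (i Fin.≟ f i) then ∅ else ⁅ f i ⁆) ≡ ∅
      lemma with i Fin.≟ f i
      ... | yes _    = refl
      ... | no  i≢fi = contradiction (≡.sym fi≡i) i≢fi

    functionGraph-arc⁺ : ∀ {i} → f i ≢ i → Arc arcs i (f i)
    functionGraph-arc⁺ {i} fi≢i =
      ≡.subst (f i ∈ₛ_) (≡.sym (functionGraph-outN fi≢i)) (Subset.x∈⁅x⁆ (f i))

    functionGraph-arc⁻ : ∀ {i j} → Arc arcs i j → f i ≡ j × f i ≢ i
    functionGraph-arc⁻ {i} {j} ij with f i Fin.≟ i
    ... | yes fi≡i = contradiction (≡.subst (j ∈ₛ_) (functionGraph-outN-fixed fi≡i) ij) Subset.∉⊥
    ... | no  fi≢i = ≡.sym (Subset.x∈⁅y⁆⇒x≡y (f i) (≡.subst (j ∈ₛ_) (functionGraph-outN fi≢i) ij)) , fi≢i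

  -- Arcs record the values at moved points. A point moved by either function has an arc in both
  -- graphs, so only points fixed by both remain.
  functionGraph-injective : ∀ f g → functionGraph f ≡ functionGraph g → ∀ i → f i ≡ g i
  functionGraph-injective f g eq i with f i Fin.≟ i | g i Fin.≟ i
  ... | yes fi≡i | yes gi≡i = ≡.trans fi≡i (≡.sym gi≡i)
  ... | no  fi≢i | _        = ≡.sym (proj₁ (functionGraph-arc⁻ g
    (≡.subst (λ E → Arc (Subgraph.arcs E) i (f i)) eq (functionGraph-arc⁺ f fi≢i))))
  ... | _        | no  gi≢i = proj₁ (functionGraph-arc⁻ f
    (≡.subst (λ E → Arc (Subgraph.arcs E) i (g i)) (≡.sym eq) (functionGraph-arc⁺ g gi≢i)))

  module _ (D : Digraph n) where
    private module D = Digraph D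

    MovesAlongArcs : (Fin n → Fin n) → Set
    MovesAlongArcs f = ∀ i → f i ≢ i → Arc D.arcs i (f i)

    functionGraph-elementary : ∀ f → (∀ {i j} → f i ≡ f j → i ≡ j) → MovesAlongArcs f →
                               IsElementary D (functionGraph f)
    functionGraph-elementary f inj along =
      (λ i j ij → let fi≡j , fi≢i = functionGraph-arc⁻ f ij in
        ≡.subst (Arc D.arcs i) fi≡j (along i fi≢i) ,
        functionGraph-verts⁺ f fi≢i ,
        functionGraph-verts⁺ f (≡.subst (λ j → f j ≢ j) fi≡j (fi≢i ∘ inj))) ,
      (λ v v∈ → let fv≢v = functionGraph-verts⁻ f v∈ in
        ≡.trans (≡.cong ∣_∣ (functionGraph-outN f fv≢v)) (Subset.∣⁅x⁆∣≡1 (f v)) ,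
        in-degree v fv≢v)
      where
      open Subgraph (functionGraph f) using (arcs)
      open FunctionalGraph arcs f inj (functionGraph-arc⁻ f) (functionGraph-arc⁺ f)
        using (period; f^; f^-suc)

      in-degree : ∀ v → f v ≢ v → ∣ inN arcs v ∣ ≡ 1
      in-degree v fv≢v = ≡.trans
        (≡.cong ∣_∣ (Subset.⊆-antisym
          (λ i∈ → ≡.subst (_∈ₛ ⁅ u ⁆)
            (inj (≡.trans fu≡v (≡.sym (proj₁ (functionGraph-arc⁻ f (∈-inN⁻ {𝒜 = arcs} i∈)))))) (Subset.x∈⁅x⁆ u))
          (λ i∈ → ≡.subst (_∈ₛ inN arcs v) (≡.sym (Subset.x∈⁅y⁆⇒x≡y u i∈)) (∈-inN⁺ {𝒜 = arcs} uv))))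
        (Subset.∣⁅x⁆∣≡1 u)
        where
        u : Fin n
        -- The last vertex before the orbit returns to `v`; injectivity alone would give uniqueness
        -- of a predecessor but not its existence.
        u = f^ (proj₁ (period v)) v
        fu≡v : f u ≡ v
        fu≡v = ≡.trans (≡.sym (f^-suc (proj₁ (period v)) v)) (proj₂ (period v))
        uv : Arc arcs u v
        uv = ≡.subst (Arc arcs u) fu≡v (functionGraph-arc⁺ f
          λ fu≡u → fv≢v (≡.trans (≡.cong f (≡.trans (≡.sym fu≡v) fu≡u)) fu≡v))

    module _ (E : Subgraph n) where
      private module E = Subgraph E

      -- The arcs of `E`, completed by fixing the vertices outside `E`. As a relation it can be
      -- applied to successors chosen from `E`, to a decoded code and to the identity.
      Successor : Fin n → Fin n → Set
      Successor v w = v ∈ₛ E.verts × outN E.arcs v ≡ ⁅ w ⁆ ⊎ v ∉ₛ E.verts × w ≡ v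

      module _ (elem : IsElementary D E) where

        successor-arc : ∀ {v w} → v ∈ₛ E.verts → outN E.arcs v ≡ ⁅ w ⁆ → Arc E.arcs v w
        successor-arc {w = w} v∈ out = ≡.subst (w ∈ₛ_) (≡.sym out) (Subset.x∈⁅x⁆ w)

        elementary-successor : ∀ v → ∃ (Successor v)
        elementary-successor v with v Subset.∈? E.verts
        ... | yes v∈ with w , out ← ∣p∣≡1⇒singleton _ (proj₁ (proj₂ elem v v∈)) = w , inj₁ (v∈ , out)
        ... | no  v∉ = v , inj₂ (v∉ , refl)

        -- Inside `E` the in-degree is one. An arc of `E` ends in `E`, so its target is never a
        -- fixed vertex outside.
        successor-injective : ∀ {i j w} → Successor i w → Successor j w → i ≡ j
        successor-injective (inj₁ (i∈ , out-i)) (inj₁ (j∈ , out-j))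
          with iw ← successor-arc i∈ out-i | jw ← successor-arc j∈ out-j
          with w∈ ← proj₂ (proj₂ (proj₁ elem _ _ iw))
          with x , in-w ← ∣p∣≡1⇒singleton _ (proj₂ (proj₂ elem _ w∈))
          = ≡.trans (only iw) (≡.sym (only jw))
          where
          only : ∀ {i} → Arc E.arcs i _ → i ≡ x
          only iw = Subset.x∈⁅y⁆⇒x≡y x (≡.subst (_ ∈ₛ_) in-w (∈-inN⁺ {𝒜 = E.arcs} iw))
        successor-injective (inj₁ (i∈ , out-i)) (inj₂ (j∉ , refl)) =
          contradiction (proj₂ (proj₂ (proj₁ elem _ _ (successor-arc i∈ out-i)))) j∉
        successor-injective (inj₂ (i∉ , refl)) (inj₁ (j∈ , out-j)) =
          contradiction (proj₂ (proj₂ (proj₁ elem _ _ (successor-arc j∈ out-j)))) i∉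
        successor-injective (inj₂ (_ , refl)) (inj₂ (_ , refl)) = refl

        -- Looplessness of `D` turns every vertex of `E` into a moved point, so vertices and moved
        -- points agree.
        successor-moves : ∀ {v w} → Successor v w → v ∈ₛ E.verts → Arc D.arcs v w × w ≢ v
        successor-moves (inj₂ (v∉ , _))   v∈ = contradiction v∈ v∉
        successor-moves (inj₁ (v∈ , out)) _  = vw , λ { refl → D.loopless _ vw }
          where
          vw : Arc D.arcs _ _
          vw = proj₁ (proj₁ elem _ _ (successor-arc v∈ out))

        module _ (f : Fin n → Fin n) (succ : ∀ v → Successor v (f v)) where

          successor-along : MovesAlongArcs f
          successor-along v fv≢v with succ v
          ... | s@(inj₁ (v∈ , _)) = proj₁ (successor-moves s v∈)
          ... | inj₂ (_ , fv≡v)   = contradiction fv≡v fv≢v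

          functionGraph-successor : functionGraph f ≡ E
          functionGraph-successor = ≡.cong₂ subgraph
            (Subset.⊆-antisym verts⊆ λ v∈ → functionGraph-verts⁺ f (proj₂ (successor-moves (succ _) v∈)))
            (≡.trans (Vec.tabulate-cong out) (Vec.tabulate∘lookup E.arcs))
            where
            verts⊆ : ∀ {v} → v ∈ₛ Subgraph.verts (functionGraph f) → v ∈ₛ E.verts
            verts⊆ {v} v∈f with succ v
            ... | inj₁ (v∈ , _)    = v∈
            ... | inj₂ (_ , fv≡v) = contradiction fv≡v (functionGraph-verts⁻ f v∈f)

            out : ∀ v → (if does (v Fin.≟ f v) then ∅ else ⁅ f v ⁆) ≡ outN E.arcs v
            out v with v Fin.≟ f v | succ v
            ... | no  _    | inj₁ (_ , out)   = ≡.sym out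
            ... | no  v≢fv | inj₂ (_ , fv≡v)  = contradiction (≡.sym fv≡v) v≢fv
            ... | yes v≡fv | s@(inj₁ (v∈ , _)) = contradiction (≡.sym v≡fv) (proj₂ (successor-moves s v∈))
            -- Arcs of `E` start at vertices of `E`, so a vertex outside has no out-neighbours.
            ... | yes _    | inj₂ (v∉ , _)    = Subset.⊆-antisym
              (λ i∈ → contradiction i∈ Subset.∉⊥)
              (λ i∈ → contradiction (proj₁ (proj₂ (proj₁ elem _ _ i∈))) v∉)

        elementary⇒code : ∃ λ c → MovesAlongArcs (decode c) × functionGraph (decode c) ≡ E
        elementary⇒code =
          let f         = proj₁ ∘ elementary-successor
              succ      = proj₂ ∘ elementary-successor
              c , c≗f   = encode f λ {i} {j} fi≡fj →
                successor-injective (succ i) (≡.subst (Successor j) (≡.sym fi≡fj) (succ j))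
              c-succ    = λ v → ≡.subst (Successor v) (≡.sym (c≗f v)) (succ v)
          in c , successor-along (decode c) c-succ , functionGraph-successor (decode c) c-succ

  ∈-allSubgraphs : ∀ E → E ∈ allSubgraphs {n}
  ∈-allSubgraphs (subgraph verts arcs) =
    ∈-cartesianProductWith⁺ subgraph (∈-vectors sides verts) (∈-vectors (∈-vectors sides) arcs)
    where
    sides : ∀ s → s ∈ outside ∷ inside ∷ []
    sides outside = here refl
    sides inside  = there (here refl)

  allSubgraphs-unique : Unique (allSubgraphs {n})
  allSubgraphs-unique = Unique.cartesianProductWith⁺ subgraph (λ { refl → refl , refl })
    (vectors-unique sides n) (vectors-unique (vectors-unique sides n) n)
    where
    sides : Unique (outside ∷ inside ∷ [])
    sides = ((λ ()) ∷ []) ∷ [] ∷ []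

-- Permutations by fixed points, elementary subdigraphs by vertices

module _ {n : ℕ} (D : Digraph n) where

  -- Spelled out like `degree`, so that the exponent in the determinant expansion is this number by
  -- definition.
  fixedPoints : (Fin n → Fin n) → ℕ
  fixedPoints f = Σℕ.Σ (λ i → if does (i Fin.≟ f i) then 1 else 0) (allFin n)

  ∣verts∣+fixedPoints : ∀ f → ∣ Subgraph.verts (functionGraph f) ∣ ℕ.+ fixedPoints f ≡ n
  ∣verts∣+fixedPoints f = ∣tabulate-not∣ λ i → does (i Fin.≟ f i)

  Compatible : ℕ → Code n → Set
  Compatible m c = MovesAlongArcs D (decode c) × fixedPoints (decode c) ≡ m

  movesAlongArcs? : ∀ f → Dec (MovesAlongArcs D f)
  movesAlongArcs? f = Fin.all? λ i → ¬? (f i Fin.≟ i) →-dec arc? (Digraph.arcs D) i (f i)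

  compatible? : ∀ m c → Dec (Compatible m c)
  compatible? m c = movesAlongArcs? (decode c) ×-dec (fixedPoints (decode c) ℕ.≟ m)

  ∈-𝓔⁺ : ∀ {k E} → IsElementary D E → ∣ Subgraph.verts E ∣ ≡ k → E ∈ 𝓔 k D
  ∈-𝓔⁺ {k} {E} elem size = ∈-filter⁺ (λ E → isElementary? D E ×-dec (∣ Subgraph.verts E ∣ ℕ.≟ k))
    (∈-allSubgraphs E) (elem , size)

  ∈-𝓔⁻ : ∀ {k E} → E ∈ 𝓔 k D → IsElementary D E × ∣ Subgraph.verts E ∣ ≡ k
  ∈-𝓔⁻ {k} E∈ = proj₂ (∈-filter⁻ (λ E → isElementary? D E ×-dec (∣ Subgraph.verts E ∣ ℕ.≟ k))
    {xs = allSubgraphs} E∈)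

  𝓔-unique : ∀ k → Unique (𝓔 k D)
  𝓔-unique k = Unique.filter⁺ (λ E → isElementary? D E ×-dec (∣ Subgraph.verts E ∣ ℕ.≟ k))
    {xs = allSubgraphs} allSubgraphs-unique

  -- Vertices and fixed points add up to `n`, so degree `m` selects the subdigraphs on n - m
  -- vertices. Neither list has repetitions, which leaves only the members to compare.
  codes↭𝓔 : ∀ {m} → m ℕ.≤ n →
            map (functionGraph ∘ decode) (filter (compatible? m) (codes n)) ↭ 𝓔 (n ∸ m) D
  codes↭𝓔 {m} m≤n = unique∧set⇒↭
    (Unique.map⁺ (λ eq → decode-determines (functionGraph-injective _ _ eq))
      (Unique.filter⁺ (compatible? m) {xs = codes n} (codes-unique n)))
    (𝓔-unique (n ∸ m)) to from
    where
    to : ∀ {E} → E ∈ map (functionGraph ∘ decode) (filter (compatible? m) (codes n)) → E ∈ 𝓔 (n ∸ m) D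
    to E∈ with c , c∈ , refl ← ∈-map⁻ (functionGraph ∘ decode) {xs = filter (compatible? m) (codes n)} E∈
      with along , fixed ← proj₂ (∈-filter⁻ (compatible? m) {xs = codes n} c∈)
      = ∈-𝓔⁺ (functionGraph-elementary D (decode c) (decode-injective c) along)
        (≡.trans (≡.sym (ℕ.m+n∸n≡m _ m))
          (≡.cong (_∸ m) (≡.trans (≡.cong (_ ℕ.+_) (≡.sym fixed)) (∣verts∣+fixedPoints (decode c)))))

    from : ∀ {E} → E ∈ 𝓔 (n ∸ m) D → E ∈ map (functionGraph ∘ decode) (filter (compatible? m) (codes n))
    from {E} E∈ with elem , size ← ∈-𝓔⁻ {n ∸ m} E∈ with c , along , refl ← elementary⇒code D E elem
      = ∈-map⁺ (functionGraph ∘ decode) (∈-filter⁺ (compatible? m) (∈-codes c) (along ,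
        ℕ.+-cancelˡ-≡ (n ∸ m) _ _ (≡.trans (≡.cong (ℕ._+ fixedPoints (decode c)) (≡.sym size))
          (≡.trans (∣verts∣+fixedPoints (decode c)) (≡.sym (ℕ.m∸n+n≡m m≤n))))))

  -- The coefficient `a` at 0 is defined to be 1, whereas the expansion yields a sum over `𝓔 0`.
  -- Without vertices there are no arcs, so the sum has one term.
  𝓔₀-↭ : functionGraph id ∷ [] ↭ 𝓔 0 D
  𝓔₀-↭ = unique∧set⇒↭ ([] ∷ []) (𝓔-unique 0)
    (λ { (here refl) → ∈-𝓔⁺ (functionGraph-elementary D id id λ i i≢i → contradiction refl i≢i)
           (≡.trans (≡.cong (∣_∣ {n}) (Subset.Empty-unique λ (i , i∈) → functionGraph-verts⁻ id i∈ refl)) (Subset.∣⊥∣≡0 n)) })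
    (λ {E} E∈ → let elem , size = ∈-𝓔⁻ {0} E∈ in here (≡.sym (functionGraph-successor D E elem id
      λ v → inj₂ ((λ v∈ → Subset.∉⊥ (≡.subst (v ∈ₛ_) (∣p∣≡0⇒empty _ size) v∈)) , refl))))

-- Coefficients as signed sums over elementary subdigraphs

module ElementarySum {a ℓ} (R : CommutativeRing a ℓ) where
  open RingTheory R
  open CommutativeRing R hiding (zero)
    renaming (refl to ≈-refl; sym to ≈-sym; trans to ≈-trans)
  open RawSemiringOps (RawRing.rawSemiring rawRing) using (_^_)
  open RingProperties ring
  open CommutativeSemigroupProperties *-commutativeSemigroup
    using (interchange)
  open ≈-Reasoning setoid
  open Polynomial rawRing using (coeff; charPoly)

  Π-scale : ∀ {b} {B : Set b} x (f : B → Carrier) ys →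
            Π (λ y → x * f y) ys ≈ x ^ List.length ys * Π f ys
  Π-scale x f []       = ≈-sym (*-identityˡ 1#)
  Π-scale x f (y ∷ ys) = ≈-trans (*-congˡ (Π-scale x f ys)) (interchange _ _ _ _)

  -1^k*-1^k≈1 : ∀ k → (- 1#) ^ k * (- 1#) ^ k ≈ 1#
  -1^k*-1^k≈1 zero    = *-identityˡ 1#
  -1^k*-1^k≈1 (suc k) = begin
    (- 1# * (- 1#) ^ k) * (- 1# * (- 1#) ^ k)   ≈⟨ interchange _ _ _ _ ⟩
    (- 1# * - 1#) * ((- 1#) ^ k * (- 1#) ^ k)   ≈⟨ *-cong (≈-trans (-1*x≈-x _) (-‿involutive 1#)) (-1^k*-1^k≈1 k) ⟩
    1# * 1#                                     ≈⟨ *-identityˡ 1# ⟩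
    1#                                          ∎

  module _ {n} (A : Matrix Carrier n) where

    walkProduct : List (Fin n) → Carrier
    walkProduct (u ∷ v ∷ vs) = A u v * walkProduct (v ∷ vs)
    walkProduct _            = 1#

    cycleProduct : List (Fin n) → Carrier
    cycleProduct []       = 1#
    cycleProduct (v ∷ vs) = walkProduct (v ∷ vs ∷ʳ v)

    signedGain : Subgraph n → Carrier
    signedGain E = (- 1#) ^ numCycles E * Π cycleProduct (directedCycles (Subgraph.arcs E))

    walkProduct-step : ∀ {f : Fin n → Fin n} {x v} vs → Linked (λ i j → f i ≡ j) (x ∷ vs ∷ʳ v) →
                       walkProduct (x ∷ vs ∷ʳ v) ≈ Π (λ i → A i (f i)) (x ∷ vs)
    walkProduct-step []       (refl ∷ [-]) = ≈-refl
    walkProduct-step (y ∷ vs) (refl ∷ p)   = *-congˡ (walkProduct-step vs p)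

    module _ (A-diag : ∀ i → A i i ≈ 0#) (c : Code n) where
      private
        f : Fin n → Fin n
        f = decode c

        𝒜 : ArcSet n
        𝒜 = Subgraph.arcs (functionGraph f)

        L : List (List (Fin n))
        L = directedCycles 𝒜

        w : Fin n → Carrier
        w i = weight A A-diag i (f i)

      open FunctionalGraph 𝒜 f (decode-injective c) (functionGraph-arc⁻ f) (functionGraph-arc⁺ f)

      weight-fixed : ∀ i → f i ≡ i → w i ≈ 1#
      weight-fixed i fi≡i with i Fin.≟ f i
      ... | yes _    = ≈-refl
      ... | no  i≢fi = contradiction (≡.sym fi≡i) i≢fi

      weight-moved : ∀ i → f i ≢ i → w i ≈ - 1# * A i (f i)
      weight-moved i fi≢i with i Fin.≟ f i
      ... | yes i≡fi = contradiction (≡.sym i≡fi) fi≢i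
      ... | no  _    = ≈-sym (-1*x≈-x _)

      directedCycle-closedWalk : ∀ {vs} → vs ∈ L → ClosedWalk f vs
      directedCycle-closedWalk {vs} vs∈ with vs | ∈-directedCycles⁻ 𝒜 vs∈
      ... | v ∷ vs | _ , _ , p = Linked.map (proj₁ ∘ functionGraph-arc⁻ f) p

      cycle-weight : ∀ {vs} → vs ∈ L → cycleSign vs * Π w vs ≈ - 1# * cycleProduct vs
      cycle-weight {vs} vs∈ with vs | directedCycle-closedWalk vs∈
        | Product.⨁-cong-∈ vs (λ u∈ → weight-moved _ (∈-directedCycles⇒moved vs∈ u∈))
      ... | v ∷ vs | p | weights = begin
        (- 1# * s) * Π w (v ∷ vs)                                   ≈⟨ *-congˡ weights ⟩
        (- 1# * s) * Π (λ i → - 1# * A i (f i)) (v ∷ vs)            ≈⟨ *-congˡ (Π-scale (- 1#) (λ i → A i (f i)) (v ∷ vs)) ⟩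
        (- 1# * s) * (s * Π (λ i → A i (f i)) (v ∷ vs))             ≈⟨ *-congˡ (*-congˡ (walkProduct-step vs p)) ⟨
        (- 1# * s) * (s * cycleProduct (v ∷ vs))                    ≈⟨ *-assoc _ _ _ ⟩
        - 1# * (s * (s * cycleProduct (v ∷ vs)))                    ≈⟨ *-congˡ (*-assoc _ _ _) ⟨
        -- One factor `s` comes from the sign of the cycle, the other from its entries.
        - 1# * ((s * s) * cycleProduct (v ∷ vs))                    ≈⟨ *-congˡ (*-congʳ (-1^k*-1^k≈1 (suc (List.length vs)))) ⟩
        - 1# * (1# * cycleProduct (v ∷ vs))                         ≈⟨ *-congˡ (*-identityˡ _) ⟩
        - 1# * cycleProduct (v ∷ vs)                                ∎
        where
        s : Carrier
        s = (- 1#) ^ suc (List.length vs)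

      sgn-directedCycles : sgn c ≈ Π cycleSign L
      sgn-directedCycles = sgn-cycles c L (All.tabulate directedCycle-closedWalk) concat-directedCycles-unique
        λ i i∉ → decidable-stable (f i Fin.≟ i) λ fi≢i →
          let vs , cyc , i∈vs = cycleThrough fi≢i in i∉ (∈-concat⁺′ i∈vs (∈-directedCycles⁺ 𝒜 cyc))

      code-weight : sgn c * Π w (allFin n) ≈ signedGain (functionGraph f)
      code-weight = begin
        sgn c * Π w (allFin n)
          ≈⟨ *-congˡ (Product.⨁-filter (λ i → ¬? (f i Fin.≟ i)) (λ i ¬¬fix → weight-fixed i (decidable-stable (f i Fin.≟ i) ¬¬fix)) (allFin n)) ⟩
        sgn c * Π w (filter (λ i → ¬? (f i Fin.≟ i)) (allFin n))
          ≈⟨ *-congˡ (Product.⨁-↭ w concat-directedCycles-↭) ⟨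
        sgn c * Π w (concat L)
          ≈⟨ *-cong sgn-directedCycles (Product.⨁-concat w L) ⟩
        Π cycleSign L * Π (Π w) L
          ≈⟨ Product.⨁-distrib-∙ cycleSign (Π w) L ⟨
        Π (λ vs → cycleSign vs * Π w vs) L
          ≈⟨ Product.⨁-cong-∈ L cycle-weight ⟩
        Π (λ vs → - 1# * cycleProduct vs) L
          ≈⟨ Π-scale (- 1#) cycleProduct L ⟩
        signedGain (functionGraph f) ∎

    module _ (D : Digraph n) (A-support : ∀ i j → ¬ Arc (Digraph.arcs D) i j → A i j ≈ 0#) where

      A-diag : ∀ i → A i i ≈ 0#
      A-diag i = A-support i i (Digraph.loopless D i)

      private
        w : Matrix Carrier n
        w = weight A A-diag

        W : Code n → Carrier
        W c = sgn c * Π (λ i → w i (decode c i)) (allFin n)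

      weight-incompatible : ∀ c → ¬ MovesAlongArcs D (decode c) → W c ≈ 0#
      weight-incompatible c ¬along
        -- The refuted implication says both that `i` is moved and that no arc leads to its image,
        -- so the factor at `i` vanishes.
        with i , ¬arc ← Fin.¬∀⟶∃¬ n (λ i → decode c i ≢ i → Arc (Digraph.arcs D) i (decode c i))
               (λ i → ¬? (decode c i Fin.≟ i) →-dec arc? (Digraph.arcs D) i (decode c i)) ¬along
        = ≈-trans (*-congˡ (Π-zero (λ i → w i (decode c i)) (∈-allFin i) (begin
            w i (decode c i)          ≈⟨ weight-moved A-diag c i (λ fi≡i → ¬arc λ fi≢i → contradiction fi≡i fi≢i) ⟩
            - 1# * A i (decode c i)   ≈⟨ *-congˡ (A-support i _ λ arc → ¬arc λ _ → arc) ⟩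
            - 1# * 0#                 ≈⟨ zeroʳ _ ⟩
            0#                        ∎))) (zeroʳ _)

      coeff-charPoly-≤ : ∀ {m} → m ℕ.≤ n → coeff (charPoly A) m ≈ Σ signedGain (𝓔 (n ∸ m) D)
      coeff-charPoly-≤ {m} m≤n = begin
        coeff (charPoly A) m
          ≈⟨ coeff-charPoly A A-diag m ⟩
        Σ (λ c → monomial (fixedPoints D (decode c)) (W c) m) (codes n)
          ≈⟨ Sum.⨁-filter (compatible? D m) incompatible (codes n) ⟩
        Σ (λ c → monomial (fixedPoints D (decode c)) (W c) m) good
          ≈⟨ Sum.⨁-cong-∈ good compatible ⟩
        Σ (signedGain ∘ functionGraph ∘ decode) good
          ≡⟨ Sum.⨁-map signedGain (functionGraph ∘ decode) good ⟨
        Σ signedGain (map (functionGraph ∘ decode) good)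
          ≈⟨ Sum.⨁-↭ signedGain (codes↭𝓔 D m≤n) ⟩
        Σ signedGain (𝓔 (n ∸ m) D) ∎
        where
        good : List (Code n)
        good = filter (compatible? D m) (codes n)

        incompatible : ∀ c → ¬ Compatible D m c → monomial (fixedPoints D (decode c)) (W c) m ≈ 0#
        incompatible c ¬comp with fixedPoints D (decode c) ℕ.≟ m
        ... | no  fixed≢m = reflexive (monomial-≢ {fixedPoints D (decode c)} {m} (W c) fixed≢m)
        ... | yes fixed≡m = ≈-trans
          (monomial-cong (fixedPoints D (decode c)) (weight-incompatible c λ along → ¬comp (along , fixed≡m)) m)
          (monomial-0 (fixedPoints D (decode c)) m)

        compatible : ∀ {c} → c ∈ good →
                     monomial (fixedPoints D (decode c)) (W c) m ≈ signedGain (functionGraph (decode c))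
        compatible {c} c∈ with _ , _ , refl ← ∈-filter⁻ (compatible? D m) {xs = codes n} c∈ =
          ≈-trans (reflexive (monomial-≡ (fixedPoints D (decode c)) (W c))) (code-weight A-diag c)

      coeff-charPoly-> : ∀ {m} → n ℕ.< m → coeff (charPoly A) m ≈ 0#
      coeff-charPoly-> {m} n<m = ≈-trans (coeff-charPoly A A-diag m)
        (Sum.⨁-identity (codes n) λ {c} _ → reflexive (monomial-≢ {fixedPoints D (decode c)} {m} (W c)
          (ℕ.<⇒≢ (ℕ.≤-<-trans (ℕ.m+n≤o⇒n≤o _ (ℕ.≤-reflexive (∣verts∣+fixedPoints D (decode c)))) n<m))))

      signedGain-𝓔₀ : Σ signedGain (𝓔 0 D) ≈ 1#
      signedGain-𝓔₀ = begin
        Σ signedGain (𝓔 0 D)                        ≈⟨ Sum.⨁-↭ signedGain (𝓔₀-↭ D) ⟨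
        signedGain (functionGraph id) + 0#          ≈⟨ +-identityʳ _ ⟩
        signedGain (functionGraph id)               ≡⟨ ≡.cong (λ L → (- 1#) ^ List.length L * Π cycleProduct L) no-cycles ⟩
        1# * 1#                                     ≈⟨ *-identityˡ 1# ⟩
        1#                                          ∎
        where
        open Subgraph (functionGraph {n} id) using (arcs)

        no-cycles : directedCycles arcs ≡ []
        no-cycles with directedCycles arcs | ∈-directedCycles⁻ arcs
        ... | []       | _     = refl
        ... | vs ∷ _ | cycle with vs | cycle (here refl)
        ... | v ∷ []      | _ , _ , r ∷ _ = contradiction refl (proj₂ (functionGraph-arc⁻ id r))
        ... | v ∷ w ∷ _   | _ , _ , r ∷ _ = contradiction refl (proj₂ (functionGraph-arc⁻ id r))

-- Gain digraphs over the complex numbers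

open Polynomial ℂ-ring using (_≈ₚ_; _*ₚ_; C; X; sum; _^_; charPoly)

module _ {n} (Φ : 𝕋GainDigraph n) where
  open 𝕋GainDigraph Φ using (digraph; arcs)
  open CommutativeRing ℂ-commutativeRing using (_≈_; 0#; 1#)
    renaming (refl to ≈-refl; sym to ≈-sym; trans to ≈-trans; reflexive to ≈-reflexive)
  open RingTheory ℂ-commutativeRing using (Σ; coeff-sum-CX^-≤; coeff-sum-CX^->)
  open ElementarySum ℂ-commutativeRing
  open Polynomial ℂ-ring using (coeff)

  gainAdjacency-support : ∀ i j → ¬ Arc arcs i j → gainAdjacency Φ i j ≈ 0#
  gainAdjacency-support i j ¬ij with arc? arcs i j
  ... | yes ij = contradiction ij ¬ij
  ... | no  _  = ≈-refl

  walkGain-walkProduct : ∀ vs → walkGain Φ vs ≡ walkProduct (gainAdjacency Φ) vs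
  walkGain-walkProduct []           = refl
  walkGain-walkProduct (u ∷ [])     = refl
  walkGain-walkProduct (u ∷ v ∷ vs) =
    ≡.cong (gainAdjacency Φ u v *ℂ_) (walkGain-walkProduct (v ∷ vs))

  cycleGain-cycleProduct : ∀ vs → cycleGain Φ vs ≡ cycleProduct (gainAdjacency Φ) vs
  cycleGain-cycleProduct []       = refl
  cycleGain-cycleProduct (v ∷ vs) = walkGain-walkProduct (v ∷ vs ∷ʳ v)

  a-signedGain : ∀ k → Σ (signedGain (gainAdjacency Φ)) (𝓔 k digraph) ≈ a Φ k
  a-signedGain zero      = signedGain-𝓔₀ (gainAdjacency Φ) digraph gainAdjacency-support
  a-signedGain k@(suc _) = ≈-reflexive (≡.cong (foldr _+ℂ_ 0#) (map-cong
    (λ E → ≡.cong (λ gains → _ *ℂ foldr _*ℂ_ 1# gains)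
      (≡.sym (map-cong cycleGain-cycleProduct (directedCycles (Subgraph.arcs E)))))
    (𝓔 k digraph)))

  charPoly-coefficients : ∀ m → coeff (charPoly (gainAdjacency Φ)) m ≈
                          coeff (sum {suc n} λ k → C (a Φ (toℕ k)) *ₚ X ^ (n ∸ toℕ k)) m
  charPoly-coefficients m with m ℕ.≤? n
  ... | yes m≤n = ≈-trans
    (coeff-charPoly-≤ (gainAdjacency Φ) digraph gainAdjacency-support m≤n)
    (≈-trans (a-signedGain (n ∸ m)) (≈-sym (coeff-sum-CX^-≤ {n} (a Φ) m≤n)))
  -- Above degree `n` both sides vanish: neither a number of fixed points nor an exponent `n ∸ k`
  -- exceeds `n`.
  ... | no  m≰n = ≈-trans
    (coeff-charPoly-> (gainAdjacency Φ) digraph gainAdjacency-support (ℕ.≰⇒> m≰n))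
    (≈-sym (coeff-sum-CX^-> {n} (a Φ) (ℕ.≰⇒> m≰n)))

corollary2p5 : ∀ (n : ℕ) (Φ : 𝕋GainDigraph n) →
    charPoly (gainAdjacency Φ) ≈ₚ sum {suc n} (λ k → C (a Φ (toℕ k)) *ₚ X ^ (n ∸ toℕ k))
corollary2p5 n Φ = charPoly-coefficients Φ
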